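{- For every integer $d\ge 2$ there exists a constant $c_d>0$ such that for every positive integer $k$ with $d\ge k\ge 2$ and every prime $q_0$, setting $q=q_0^k$, one has $$\mathrm{IM}(d,q)\ \ge\ c_d\, q^{d-1/k}.$$
   Context: For an integer $d\ge 1$ and a prime power $q$, $\mathrm{IM}(d,q)$ denotes the maximum size of an induced matching in the bipartite point-line incidence graph of $\mathbb{F}_q^d$; equivalently, the largest $m$ for which there exist pairs $(p_1,\ell_1),\dots,(p_m,\ell_m)$ with $p_i\in\mathbb{F}_q^d$ points and $\ell_j\subset\mathbb{F}_q^d$ affine lines such that $p_i\in\ell_j$ if and only if $i=j$. -}

module Defs where

open import Algebra.Apartness.Bundles using (HeytingField)
open import Data.Fin.Base using (Fin; finToFun; funToFin)
open import Data.Fin.Properties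
  using (_≟_; any?; all?; injective⇒≤; finToFun-funToFin)
open import Data.Nat.Base using (ℕ; zero; suc; _^_; _≤_)
open import Data.Nat.Properties using (≤-refl; ≤∧≢⇒<; ≤-pred)
open import Data.Product.Base using (∃; _×_; _,_; proj₁; proj₂)
open import Data.Vec.Functional using (Vector)
open import Function.Base using (_∘_)
open import Function.Bundles using (Inverse; _⇔_; mk⇔; module Equivalence)
open import Level using (Level; _⊔_) renaming (suc to lsuc)
open import Relation.Binary.Core using (Rel)
open import Relation.Binary.PropositionalEquality as ≡ using (_≡_; refl)
open import Relation.Nullary using (¬_; Dec; yes; no)
open import Relation.Nullary.Decidable using (map′; ¬?; _×-dec_; _→-dec_)

-- Finite fields of order q are unique up to isomorphism, so a claim about 𝔽_q
-- is a claim about every inhabitant.  The apartness of a finite Heyting field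
-- is necessarily the negation of _≈_.
record FiniteField (c ℓ₁ ℓ₂ : Level) (q : ℕ) : Set (lsuc (c ⊔ ℓ₁ ⊔ ℓ₂)) where
  field
    heytingField : HeytingField c ℓ₁ ℓ₂

  open HeytingField heytingField public

  field
    enumeration : Inverse setoid (≡.setoid (Fin q))

------------------------------------------------------------------------
-- Points, lines and induced matchings of the incidence graph of 𝔽_q^d

module Geometry {c ℓ₁ ℓ₂ q} (F : FiniteField c ℓ₁ ℓ₂ q) (d : ℕ) where
  open FiniteField F using (Carrier; _≈_; _+_; 0#) renaming (_*_ to _·_)

  Point : Set c
  Point = Vector Carrier d

  infix 4 _≋_
  _≋_ : Rel Point ℓ₁
  u ≋ v = ∀ i → u i ≈ v i

  𝟎 : Point
  𝟎 _ = 0#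

  -- Several values of this type may present the same point set
  -- { base + t · direction }.  This does not affect matchings, whose lines are
  -- distinguished by their incidences.
  record Line : Set (c ⊔ ℓ₁) where
    constructor mkLine
    field
      base        : Point
      direction   : Point
      direction≉𝟎 : ¬ direction ≋ 𝟎

  infix 4 _∈_
  _∈_ : Point → Line → Set (c ⊔ ℓ₁)
  p ∈ l = ∃ λ t → p ≋ (λ i → base i + t · direction i)
    where
    open Line l

  record InducedMatching (m : ℕ) : Set (c ⊔ ℓ₁) where
    field
      point    : Fin m → Point
      line     : Fin m → Line
      incident : ∀ i j → point i ∈ line j ⇔ i ≡ j

  record IsMaximumMatchingSize (m : ℕ) : Set (c ⊔ ℓ₁) where
    field
      attained : InducedMatching m
      maximum  : ∀ n → InducedMatching n → n ≤ m

------------------------------------------------------------------------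
-- Exhaustive search, used only to show that a maximum exists

private
  record Listing {a r} {A : Set a} (_~_ : Rel A r) : Set (a ⊔ r) where
    field
      {size} : ℕ
      item   : Fin size → A
      covers : ∀ x → ∃ λ i → item i ~ x

  search : ∀ {a r p} {A : Set a} {_~_ : Rel A r} → Listing _~_ →
           {P : A → Set p} → (∀ {x y} → y ~ x → P x → P y) →
           (∀ x → Dec (P x)) → Dec (∃ P)
  search L resp P? = map′ (λ (i , Pi) → item i , Pi)
    (λ (x , Px) → proj₁ (covers x) , resp (proj₂ (covers x)) Px)
    (any? (P? ∘ item))
    where
    open Listing L

  vectors : ∀ {a r} {A : Set a} {_~_ : Rel A r} → (∀ {x y z} → x ~ y → y ~ z → x ~ z) →
            (∀ {x} → x ~ x) → Listing _~_ → ∀ n →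
            Listing {A = Vector A n} (λ u v → ∀ i → u i ~ v i)
  vectors {_~_ = _~_} trans rfl L n = record
    { item   = λ k i → item (finToFun k i)
    ; covers = λ v → let f = λ i → proj₁ (covers (v i)) in funToFin f , λ i →
        trans (≡.subst (λ z → item (finToFun (funToFin f) i) ~ item z)
                       (finToFun-funToFin f i) rfl)
              (proj₂ (covers (v i)))
    }
    where
    open Listing L

  greatest : ∀ {p} {P : ℕ → Set p} → (∀ n → Dec (P n)) → P 0 →
             ∀ N → (∀ n → P n → n ≤ N) →
             ∃ λ m → P m × (∀ n → P n → n ≤ m)
  greatest P? P0 zero    bound = 0 , P0 , bound
  greatest P? P0 (suc N) bound with P? (suc N)
  ... | yes PN = suc N , PN , bound
  ... | no ¬PN = greatest P? P0 N λ n Pn →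
    ≤-pred (≤∧≢⇒< (bound n Pn) λ { refl → ¬PN Pn })

module _ {c ℓ₁ ℓ₂ q} (F : FiniteField c ℓ₁ ℓ₂ q) (d : ℕ) where
  open Geometry F d
  open FiniteField F hiding (refl; sym; trans; _*_) 
  private
    module K = FiniteField F
    module E = Inverse enumeration

    elements : Listing _≈_
    elements = record { item = E.from ; covers = λ x → E.to x , E.inverseʳ refl }

    _≈?_ : ∀ x y → Dec (x ≈ y)
    x ≈? y = map′
      (λ eq → K.trans (K.sym (E.inverseʳ refl)) (E.inverseʳ eq))
      E.to-cong (E.to x ≟ E.to y)

    On : Point → Point → Point → Set _
    On p b v = ∃ λ t → p ≋ (λ i → b i + t K.* v i)

    On-resp : ∀ {p p′ b b′ v v′} → p′ ≋ p → b′ ≋ b → v′ ≋ v → On p b v → On p′ b′ v′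
    On-resp p≋ b≋ v≋ (t , on) = t , λ i →
      K.trans (p≋ i) (K.trans (on i)
        (K.sym (K.+-cong (b≋ i) (K.*-cong K.refl (v≋ i)))))

    on? : ∀ p b v → Dec (On p b v)
    on? p b v = search elements
      (λ y~x eq i → K.trans (eq i) (K.+-cong K.refl (K.*-cong (K.sym y~x) K.refl)))
      (λ t → all? λ i → p i ≈? (b i + t K.* v i))

    Good : ∀ {m} → Vector Point m → Vector Point m → Vector Point m → Set _
    Good {m} p b v = (∀ j → ¬ v j ≋ 𝟎) × (∀ i j → (On (p i) (b j) (v j) → i ≡ j) × (i ≡ j → On (p i) (b j) (v j)))

    good? : ∀ {m} (p b v : Vector Point m) → Dec (Good p b v)
    good? p b v =
      (all? λ j → ¬? (all? λ i → v j i ≈? 0#)) ×-dec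
      (all? λ i → all? λ j →
        (on? (p i) (b j) (v j) →-dec (i ≟ j)) ×-dec ((i ≟ j) →-dec on? (p i) (b j) (v j)))

    ≋-refl : ∀ {u} → u ≋ u
    ≋-refl i = K.refl

    ≋-sym : ∀ {u v} → u ≋ v → v ≋ u
    ≋-sym e i = K.sym (e i)

    ≋-trans : ∀ {u v w} → u ≋ v → v ≋ w → u ≋ w
    ≋-trans e f i = K.trans (e i) (f i)

    Good-resp : ∀ {m} {p p′ b b′ v v′ : Vector Point m} →
                (∀ i → p′ i ≋ p i) → (∀ i → b′ i ≋ b i) → (∀ i → v′ i ≋ v i) →
                Good p b v → Good p′ b′ v′
    Good-resp p≋ b≋ v≋ (nz , inc) =
      (λ j v′≋𝟎 → nz j (≋-trans (≋-sym (v≋ j)) v′≋𝟎)) ,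
      λ i j →
        (λ on → proj₁ (inc i j) (On-resp (≋-sym (p≋ i)) (≋-sym (b≋ j)) (≋-sym (v≋ j)) on)) ,
        (λ eq → On-resp (p≋ i) (b≋ j) (v≋ j) (proj₂ (inc i j) eq))

    points : ∀ m → Listing {A = Vector Point m} (λ u v → ∀ i → u i ≋ v i)
    points m = vectors (λ {u} {v} {w} → ≋-trans {u} {v} {w}) (λ {u} → ≋-refl {u})
                       (vectors K.trans K.refl elements d) m

    inducedMatching? : ∀ m → Dec (InducedMatching m)
    inducedMatching? m = map′
      (λ (p , b , v , nz , inc) → record
        { point = p
        ; line = λ j → mkLine (b j) (v j) (nz j)
        ; incident = λ i j → mk⇔ (proj₁ (inc i j)) (proj₂ (inc i j)) })
      (λ M →
        point M , Line.base ∘ line M , Line.direction ∘ line M , Line.direction≉𝟎 ∘ line M ,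
        λ i j → Equivalence.to (incident M i j) , Equivalence.from (incident M i j))
      (search (points m)
        (λ e (b , v , g) → b , v , Good-resp e (λ _ → ≋-refl) (λ _ → ≋-refl) g)
        λ p → search (points m)
          (λ e (v , g) → v , Good-resp (λ _ → ≋-refl) e (λ _ → ≋-refl) g)
          λ b → search (points m)
            (λ e g → Good-resp (λ _ → ≋-refl) (λ _ → ≋-refl) e g)
            λ v → good? p b v)
      where
      open InducedMatching

    bounded : ∀ m → InducedMatching m → m ≤ q ^ d
    bounded m M = injective⇒≤ {f = code} code-injective
      where
      open InducedMatching M
      code : Fin m → Fin (q ^ d)
      code i = funToFin (E.to ∘ point i)
      code-injective : ∀ {i j} → code i ≡ code j → i ≡ j
      code-injective {i} {j} eq = Equivalence.to (incident i j)
        (On-resp {p = point j} {b = Line.base (line j)} {v = Line.direction (line j)}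
          same ≋-refl ≋-refl (Equivalence.from (incident j j) refl))
        where
        same : point i ≋ point j
        same x = K.trans (K.sym (E.inverseʳ refl)) (E.inverseʳ
          (≡.trans (≡.sym (finToFun-funToFin (E.to ∘ point i) x))
          (≡.trans (≡.cong (λ k → finToFun k x) eq)
                   (finToFun-funToFin (E.to ∘ point j) x))))

  abstract
    maximumMatchingSize : ∃ IsMaximumMatchingSize
    maximumMatchingSize =
      let m , M , max = greatest inducedMatching? empty (q ^ d) bounded
      in m , record { attained = M ; maximum = max }
      where
      empty : InducedMatching 0
      empty = record { point = λ () ; line = λ () ; incident = λ () }

  IM : ℕ
  IM = proj₁ maximumMatchingSize

{-# OPTIONS --safe #-}

-- Let σ x = x^q₀ on 𝔽_q, q = q₀^k, and let M x = det (σʲ xᵢ) be the Moore determinant of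
-- x ∈ 𝔽_q^k.  Multilinearity, applied to the columns σʲ x + σʲ t · σʲ⁺¹ x with σᵏ = id, gives
--   M (x + t σ x) = M x + N t · (M x)^q₀,   N t = ∏ σʲ t,
-- so the line through x with direction σ x leaves the level set of M at x whenever M x ≠ 0, and
-- the points of a nonzero level set form an induced matching with these lines.
-- Rotating the columns shows (M x)^q₀ = ± M x, so M takes at most q₀ values.  As a polynomial
-- in x₁ it has degree q₀^(k-1) and leading coefficient ± M (x₂ , … , x_k), so inductively M is
-- nonzero at ∏ (q - q₀ʲ) ≥ (q / 2)^k points or more.  By pigeonhole some nonzero value is taken
-- at least q^k / (2^k q₀) times.  For d > k take the product of this level set with 𝔽_q^(d-k).
module Submission where

open import Algebra.Bundles using (CommutativeRing)
open import Algebra.Morphism.Structures using (IsRingHomomorphism)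
import Algebra.Properties.CommutativeMonoid.Sum as CommutativeMonoidSum
import Algebra.Properties.CommutativeSemigroup as CommutativeSemigroupProperties
open import Data.Bool.Base using (Bool; true; false)
open import Data.Fin.Base
  using (Fin; zero; suc; punchIn; fromℕ; inject₁; _↑ˡ_; _↑ʳ_; remQuot; combine; finToFun; funToFin)
open import Data.Fin.Permutation
  using (Permutation′; permutation; _⟨$⟩ʳ_; remove; punchIn-permute)
open import Data.Fin.Properties
  using (_≟_; toℕ<n; toℕ-fromℕ; toℕ-inject₁; punchInᵢ≢i; combine-remQuot; funToFin-finToFin)
open import Data.List.Base using (List; []; _∷_; length; filter; lookup; concatMap; map; allFin)
open import Data.List.Membership.Propositional using (_∈_)
open import Data.List.Membership.Propositional.Properties
  using (∈-filter⁺; ∈-allFin; ∈-lookup; ∈-map⁻)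
open import Data.List.Properties using (length-map; length-tabulate; length-++)
open import Data.List.Relation.Binary.Disjoint.Propositional using (Disjoint)
open import Data.List.Relation.Unary.All as All using (All; []; _∷_)
import Data.List.Relation.Unary.All.Properties as All
open import Data.List.Relation.Unary.AllPairs as AllPairs using (AllPairs; []; _∷_)
import Data.List.Relation.Unary.AllPairs.Properties as AllPairs
open import Data.List.Relation.Unary.Any using (here; there)
open import Data.List.Relation.Unary.Unique.Propositional using (Unique)
import Data.List.Relation.Unary.Unique.Propositional.Properties as Unique
open import Data.Nat.Base as ℕ
  using (ℕ; zero; suc; _∸_; z≤n; s≤s; z<s; _≤′_; ≤′-reflexive; ≤′-step) renaming (_^_ to _^ℕ_)
open import Data.Nat.Combinatorics using (_C_; nCk+nC[k+1]≡[n+1]C[k+1]; k>n⇒nCk≡0; nCn≡1)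
open import Data.Nat.Divisibility using (_∣_; divides; m∣m*n; >⇒∤)
open import Data.Nat.Primality using (Prime; euclidsLemma; ¬prime[0]; prime⇒nonTrivial)
import Data.Nat.Properties as ℕ
open import Data.Product.Base using (∃; ∃₂; _×_; _,_; proj₁; proj₂)
open import Data.Sum.Base using (_⊎_; inj₁; inj₂; [_,_]′)
open import Data.Vec.Base using (Vec; []; _∷_; replicate)
open import Data.Vec.Functional as Vector using (Vector; tail) renaming (_∷_ to _⊹_)
open import Data.Vec.Functional.Properties using (lookup-++ˡ; lookup-++ʳ)
open import Data.Vec.Properties using (∷-injectiveˡ; ∷-injectiveʳ)
open import Function.Base using (_∘_; id)
open import Function.Bundles using (Inverse; mk⇔)
open import Level using (_⊔_)
open import Relation.Binary.Definitions using (DecidableEquality)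
open import Relation.Binary.PropositionalEquality as ≡ using (_≡_)
open import Relation.Nullary using (¬_; Dec; yes; no; does; contradiction)
open import Relation.Nullary.Decidable using (map′; decidable-stable; toSum; ¬?)
open import Relation.Unary using (Pred; Decidable)
open import Defs

-- Binomial coefficients modulo a prime, and inequalities with constants.

module NaturalArithmetic where
  open import Data.Nat.Base using (_+_; _*_; _≤_; _<_; _^_)
  open import Data.Nat.Properties

  prime⇒1<p : ∀ {p} → Prime p → 1 < p
  prime⇒1<p {p} p-prime = ℕ.nonTrivial⇒n>1 p {{prime⇒nonTrivial p-prime}}

  -- Absorption, by induction on n: Pascal's rule splits the left side, and a second use of it
  -- reassembles the pieces.
  [k+1]*[n+1]C[k+1]≡[n+1]*nCk : ∀ n k → suc k * (suc n C suc k) ≡ suc n * (n C k)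
  [k+1]*[n+1]C[k+1]≡[n+1]*nCk zero    zero    = ≡.refl
  [k+1]*[n+1]C[k+1]≡[n+1]*nCk zero    (suc k)
    rewrite k>n⇒nCk≡0 {1} {suc (suc k)} (s≤s (s≤s z≤n)) | k>n⇒nCk≡0 {0} {suc k} z<s = *-zeroʳ k
  [k+1]*[n+1]C[k+1]≡[n+1]*nCk (suc n) k = begin
    suc k * (suc (suc n) C suc k)
      ≡⟨ ≡.cong (suc k *_) (nCk+nC[k+1]≡[n+1]C[k+1] (suc n) k) ⟨
    suc k * ((suc n C k) + (suc n C suc k))
      ≡⟨ *-distribˡ-+ (suc k) (suc n C k) _ ⟩
    suc k * (suc n C k) + suc k * (suc n C suc k)
      ≡⟨ ≡.cong (suc k * (suc n C k) +_) ([k+1]*[n+1]C[k+1]≡[n+1]*nCk n k) ⟩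
    suc k * (suc n C k) + suc n * (n C k)
      ≡⟨ step k ⟩
    suc (suc n) * (suc n C k) ∎
    where
    open ≡.≡-Reasoning
    step : ∀ k → suc k * (suc n C k) + suc n * (n C k) ≡ suc (suc n) * (suc n C k)
    step zero    = ≡.refl
    step (suc j) = begin
      (suc n C suc j) + suc j * (suc n C suc j) + suc n * (n C suc j)
        ≡⟨ ≡.cong (λ z → (suc n C suc j) + z + suc n * (n C suc j)) ([k+1]*[n+1]C[k+1]≡[n+1]*nCk n j) ⟩
      (suc n C suc j) + suc n * (n C j) + suc n * (n C suc j)
        ≡⟨ +-assoc (suc n C suc j) _ _ ⟩
      (suc n C suc j) + (suc n * (n C j) + suc n * (n C suc j))
        ≡⟨ ≡.cong ((suc n C suc j) +_) (*-distribˡ-+ (suc n) (n C j) _) ⟨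
      (suc n C suc j) + suc n * ((n C j) + (n C suc j))
        ≡⟨ ≡.cong (λ z → (suc n C suc j) + suc n * z) (nCk+nC[k+1]≡[n+1]C[k+1] n j) ⟩
      suc (suc n) * (suc n C suc j) ∎

  -- By absorption p divides k times the coefficient, and it is too large to divide k.
  p∣pCk : ∀ {p k} → Prime p → 0 < k → k < p → p ∣ p C k
  p∣pCk {suc n} {suc k} p-prime _ k<p = [ (λ p∣k → contradiction p∣k (>⇒∤ k<p)) , id ]′
    (euclidsLemma (suc k) (suc n C suc k) p-prime
      (≡.subst (suc n ∣_) (≡.sym ([k+1]*[n+1]C[k+1]≡[n+1]*nCk n k)) (m∣m*n (n C k))))

  m+n≡o⇒2m≤o⇒o≤2n : ∀ {m n o} → m + n ≡ o → 2 * m ≤ o → o ≤ 2 * n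
  m+n≡o⇒2m≤o⇒o≤2n {m} {n} ≡.refl 2m≤m+n = begin
    m + n             ≤⟨ +-monoˡ-≤ n m≤n ⟩
    n + n             ≡⟨ ≡.cong (n +_) (+-identityʳ n) ⟨
    2 * n             ∎
    where
    open ≤-Reasoning
    m≤n : m ≤ n
    m≤n = ≡.subst (_≤ n) (+-identityʳ m) (+-cancelˡ-≤ m _ _ 2m≤m+n)

  *-chain-≤ : ∀ a b c {x l m} → x ≤ c * l → a * l ≤ b * m → a * x ≤ b * c * m
  *-chain-≤ a b c {x} {l} {m} x≤cl al≤bm = begin
    a * x            ≤⟨ *-monoʳ-≤ a x≤cl ⟩
    a * (c * l)    ≡⟨ x∙yz≈y∙xz a c l ⟩
    c * (a * l)    ≤⟨ *-monoʳ-≤ c al≤bm ⟩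
    c * (b * m)    ≡⟨ x∙yz≈yx∙z c b m ⟩
    b * c * m      ∎
    where
    open ≤-Reasoning
    open CommutativeSemigroupProperties *-commutativeSemigroup using (x∙yz≈y∙xz; x∙yz≈yx∙z)

-- Counting in lists and the pigeonhole principle.

module ListCounting where
  open import Data.Nat.Base using (_+_; _*_; _≤_)
  open import Data.Nat.Properties

  module _ {a p} {A : Set a} {P : Pred A p} (P? : Decidable P) where
    length-filter-¬? : ∀ xs → length (filter P? xs) + length (filter (¬? ∘ P?) xs) ≡ length xs
    length-filter-¬? []       = ≡.refl
    length-filter-¬? (x ∷ xs) with does (P? x)
    ... | true  = ≡.cong suc (length-filter-¬? xs)
    ... | false = ≡.trans (+-suc _ _) (≡.cong suc (length-filter-¬? xs))

    module _ {q} {Q : Pred A q} (Q? : Decidable Q) where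
      length-filter-filter : ∀ xs → length (filter Q? (filter P? xs)) ≤ length (filter Q? xs)
      length-filter-filter []       = z≤n
      length-filter-filter (x ∷ xs) with does (P? x)
      ... | true  with does (Q? x)
      ...   | true  = s≤s (length-filter-filter xs)
      ...   | false = length-filter-filter xs
      length-filter-filter (x ∷ xs) | false with does (Q? x)
      ...   | true  = m≤n⇒m≤1+n (length-filter-filter xs)
      ...   | false = length-filter-filter xs

  lookup-injective : ∀ {a} {A : Set a} {xs : List A} → Unique xs →
                     ∀ i j → lookup xs i ≡ lookup xs j → i ≡ j
  lookup-injective (x∉ ∷ _) zero    zero    eq = ≡.refl
  lookup-injective (x∉ ∷ _) zero    (suc j) eq = contradiction eq (All.lookup x∉ (∈-lookup j))
  lookup-injective (x∉ ∷ _) (suc i) zero    eq = contradiction (≡.sym eq) (All.lookup x∉ (∈-lookup i))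
  lookup-injective (_  ∷ u) (suc i) (suc j) eq = ≡.cong suc (lookup-injective u i j eq)

  -- The hypothesis says that each piece has length at least c / d, kept free of division.
  length-concatMap : ∀ {a b} {A : Set a} {B : Set b} (f : A → List B) {c d} {xs} →
                     All (λ x → c ≤ d * length (f x)) xs →
                     c * length xs ≤ d * length (concatMap f xs)
  length-concatMap f {c} []                          = ≤-trans (≤-reflexive (*-zeroʳ c)) z≤n
  length-concatMap f {c} {d} {x ∷ xs} (c≤ ∷ cs≤) = begin
    c * suc (length xs)                                ≡⟨ *-suc c _ ⟩
    c + c * length xs                                  ≤⟨ +-mono-≤ c≤ (length-concatMap f {d = d} cs≤) ⟩
    d * length (f x) + d * length (concatMap f xs)     ≡⟨ *-distribˡ-+ d _ _ ⟨
    d * (length (f x) + length (concatMap f xs))       ≡⟨ ≡.cong (d *_) (length-++ (f x)) ⟨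
    d * length (concatMap f (x ∷ xs))                  ∎
    where
    open ≤-Reasoning

  module _ {a b} {A : Set a} {B : Set b} (_≟_ : DecidableEquality B) (f : A → B) where
    private
      fibre : B → List A → List A
      fibre y = filter (λ x → f x ≟ y)

    -- Remove the fibre of the first value, take a popular value for the remainder, and keep
    -- whichever of the two has the larger fibre in the whole list.
    pigeonhole-filter : B → ∀ ys {xs} → All (λ x → f x ∈ ys) xs →
                        ∃ λ y → length xs ≤ length ys * length (filter (λ x → f x ≟ y) xs)
    -- Without admissible values the list is empty, so the default y₀ will do.
    pigeonhole-filter y₀ []       []            = y₀ , z≤n
    pigeonhole-filter y₀ (y ∷ ys) {xs} f∈y∷ys =
      let y′ , bound = pigeonhole-filter y₀ ys rest∈ys
          split = begin
            length xs
              ≡⟨ length-filter-¬? (λ x → f x ≟ y) xs ⟨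
            length (fibre y xs) + length rest
              ≤⟨ +-monoʳ-≤ _ bound ⟩
            length (fibre y xs) + length ys * length (fibre y′ rest)
              ≤⟨ +-monoʳ-≤ _ (*-monoʳ-≤ (length ys) (length-filter-filter _ _ xs)) ⟩
            length (fibre y xs) + length ys * length (fibre y′ xs) ∎
      in [ (λ le → y′ , ≤-trans split (+-monoˡ-≤ _ le))
         , (λ le → y , ≤-trans split (+-monoʳ-≤ _ (*-monoʳ-≤ (length ys) le))) ]′
         (≤-total (length (fibre y xs)) (length (fibre y′ xs)))
      where
      open ≤-Reasoning
      rest : List A
      rest = filter (λ x → ¬? (f x ≟ y)) xs

      rest∈ys : All (λ x → f x ∈ ys) rest
      rest∈ys = All.map
        (λ { (here fx≡y , fx≢y) → contradiction fx≡y fx≢y ; (there fx∈ys , _) → fx∈ys })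
        (All.zip (All.filter⁺ _ f∈y∷ys , All.all-filter _ xs))

  finToFun-injective : ∀ {m n} (i j : Fin (m ^ℕ n)) →
                       (∀ x → finToFun {m} {n} i x ≡ finToFun j x) → i ≡ j
  finToFun-injective {m} {n} i j eq = ≡.trans (≡.sym (funToFin-finToFin {n} i))
    (≡.trans (funToFin-cong {n} eq) (funToFin-finToFin {n} j))
    where
    funToFin-cong : ∀ {n} {f g : Fin n → Fin m} → (∀ x → f x ≡ g x) → funToFin f ≡ funToFin g
    funToFin-cong {zero}  eq = ≡.refl
    funToFin-cong {suc n} eq = ≡.cong₂ combine (eq zero) (funToFin-cong (eq ∘ suc))

-- Characteristic, and signs as scalars.

module RingLemmas {c ℓ} (R : CommutativeRing c ℓ) where
  open CommutativeRing R
  open import Relation.Binary.Reasoning.Setoid setoid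
  open import Algebra.Properties.Ring ring using (-1*x≈-x; -‿involutive)
  open import Algebra.Properties.Semiring.Mult semiring using () renaming (_×_ to _·_)

  CharacteristicDivides : ℕ → Set ℓ
  CharacteristicDivides n = n · 1# ≈ 0#

  -- Signs are written as factors `-1#`, which the semiring solver below can treat as an ordinary
  -- variable.
  -1# : Carrier
  -1# = - 1#

  x+-1*x≈0 : ∀ x → x + -1# * x ≈ 0#
  x+-1*x≈0 x = trans (+-congˡ (-1*x≈-x x)) (-‿inverseʳ x)

  -1*-1*x≈x : ∀ x → -1# * (-1# * x) ≈ x
  -1*-1*x≈x x = trans (-1*x≈-x _) (trans (-‿cong (-1*x≈-x x)) (-‿involutive x))

-- Exterior algebra in coordinates.

module Exterior {c ℓ} (R : CommutativeRing c ℓ) where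
  open CommutativeRing R hiding (zero)
  open RingLemmas R
  open import Algebra.Properties.Semiring.Exp semiring using (_^_)
  open import Algebra.Solver.Ring.NaturalCoefficients.Default commutativeSemiring
    using (solve; _:+_; _:*_; _:=_; con)
  open import Relation.Binary.Reasoning.Setoid setoid

  private variable
    n : ℕ

  -- Coordinates of an element of Λ(Rⁿ) in the basis indexed by subsets.  Splitting off the first
  -- basis vector e, the recursion for _∧_ is (a e + v) ∧ (ω₀ + e ∧ ω₁) = v ∧ ω₀ + e ∧ (a ω₀ - v ∧ ω₁).
  Form : ℕ → Set c
  Form n = Vec Bool n → Carrier

  infix 4 _≋_
  _≋_ : Form n → Form n → Set ℓ
  ω ≋ η = ∀ s → ω s ≈ η s

  infixr 7 _∧_
  _∧_ : Vector Carrier n → Form n → Form n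
  (v ∧ ω) []          = 0#
  (v ∧ ω) (false ∷ s) = (tail v ∧ (ω ∘ (false ∷_))) s
  (v ∧ ω) (true ∷ s)  = v zero * ω (false ∷ s) + -1# * (tail v ∧ (ω ∘ (true ∷_))) s

  ∧-cong : ∀ {u v : Vector Carrier n} {ω η} → (∀ i → u i ≈ v i) → ω ≋ η → u ∧ ω ≋ v ∧ η
  ∧-cong u≈v ω≋η []          = refl
  ∧-cong u≈v ω≋η (false ∷ s) = ∧-cong (u≈v ∘ suc) (ω≋η ∘ (false ∷_)) s
  ∧-cong u≈v ω≋η (true ∷ s)  = +-cong (*-cong (u≈v zero) (ω≋η _))
    (*-congˡ (∧-cong (u≈v ∘ suc) (ω≋η ∘ (true ∷_)) s))

  ∧-congʳ : ∀ (v : Vector Carrier n) {ω η} → ω ≋ η → v ∧ ω ≋ v ∧ η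
  ∧-congʳ v = ∧-cong {u = v} (λ _ → refl)

  ∧-linearˡ : ∀ (u v : Vector Carrier n) a ω →
              (λ i → u i + a * v i) ∧ ω ≋ λ s → (u ∧ ω) s + a * (v ∧ ω) s
  ∧-linearˡ u v a ω []          = solve 1 (λ a → con 0 := con 0 :+ a :* con 0) refl a
  ∧-linearˡ u v a ω (false ∷ s) = ∧-linearˡ (tail u) (tail v) a _ s
  ∧-linearˡ u v a ω (true ∷ s)  = trans
    (+-congˡ (*-congˡ (∧-linearˡ (tail u) (tail v) a _ s)))
    (solve 7 (λ u₀ v₀ a w e x y →
      (u₀ :+ a :* v₀) :* w :+ e :* (x :+ a :* y) :=
      (u₀ :* w :+ e :* x) :+ a :* (v₀ :* w :+ e :* y)) refl _ _ a _ -1# _ _)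

  ∧-linearʳ : ∀ (v : Vector Carrier n) ω a η →
              v ∧ (λ s → ω s + a * η s) ≋ λ s → (v ∧ ω) s + a * (v ∧ η) s
  ∧-linearʳ v ω a η []          = solve 1 (λ a → con 0 := con 0 :+ a :* con 0) refl a
  ∧-linearʳ v ω a η (false ∷ s) = ∧-linearʳ (tail v) _ a _ s
  ∧-linearʳ v ω a η (true ∷ s)  = trans
    (+-congˡ (*-congˡ (∧-linearʳ (tail v) _ a _ s)))
    (solve 7 (λ v₀ w a w′ e x y →
      v₀ :* (w :+ a :* w′) :+ e :* (x :+ a :* y) :=
      (v₀ :* w :+ e :* x) :+ a :* (v₀ :* w′ :+ e :* y)) refl _ _ a _ -1# _ _)

  ∧-zeroʳ : ∀ (v : Vector Carrier n) → v ∧ (λ _ → 0#) ≋ λ _ → 0#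
  ∧-zeroʳ v []          = refl
  ∧-zeroʳ v (false ∷ s) = ∧-zeroʳ (tail v) s
  ∧-zeroʳ v (true ∷ s)  = trans (+-congˡ (*-congˡ (∧-zeroʳ (tail v) s)))
    (solve 2 (λ v₀ e → v₀ :* con 0 :+ e :* con 0 := con 0) refl _ -1#)

  ∧-scaleʳ : ∀ (v : Vector Carrier n) a ω → v ∧ (λ s → a * ω s) ≋ λ s → a * (v ∧ ω) s
  ∧-scaleʳ v a ω s = begin
    (v ∧ (λ s → a * ω s)) s           ≈⟨ ∧-congʳ v (λ _ → +-identityˡ _) s ⟨
    (v ∧ (λ s → 0# + a * ω s)) s      ≈⟨ ∧-linearʳ v _ a ω s ⟩
    (v ∧ (λ _ → 0#)) s + a * (v ∧ ω) s ≈⟨ +-congʳ (∧-zeroʳ v s) ⟩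
    0# + a * (v ∧ ω) s                ≈⟨ +-identityˡ _ ⟩
    a * (v ∧ ω) s                     ∎

  -- In a component containing e, either copy of v may supply e, and these two contributions have
  -- opposite signs. What remains is a double wedge with the tail, zero by induction.
  ∧-nilpotent : ∀ (v : Vector Carrier n) ω → v ∧ v ∧ ω ≋ λ _ → 0#
  ∧-nilpotent v ω []          = refl
  ∧-nilpotent v ω (false ∷ s) = ∧-nilpotent (tail v) _ s
  ∧-nilpotent v ω (true ∷ s)  = begin
    v₀ * x + -1# * (tail v ∧ (λ s → v₀ * ω (false ∷ s) + -1# * η s)) s
      ≈⟨ +-congˡ (*-congˡ (∧-linearʳ (tail v) _ -1# _ s)) ⟩
    v₀ * x + -1# * ((tail v ∧ (λ s → v₀ * ω (false ∷ s))) s + -1# * (tail v ∧ η) s)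
      ≈⟨ +-congˡ (*-congˡ (+-cong (∧-scaleʳ (tail v) v₀ _ s)
           (*-congˡ (∧-nilpotent (tail v) _ s)))) ⟩
    v₀ * x + -1# * (v₀ * x + -1# * 0#)
      ≈⟨ solve 2 (λ y e → y :+ e :* (y :+ e :* con 0) := y :+ e :* y) refl _ -1# ⟩
    v₀ * x + -1# * (v₀ * x)
      ≈⟨ x+-1*x≈0 _ ⟩
    0# ∎
    where
    v₀ = v zero
    x  = (tail v ∧ (ω ∘ (false ∷_))) s
    η  = tail v ∧ (ω ∘ (true ∷_))

  ∧-anticomm : ∀ (u v : Vector Carrier n) ω → u ∧ v ∧ ω ≋ λ s → -1# * (v ∧ u ∧ ω) s
  ∧-anticomm u v ω []          = sym (zeroʳ -1#)
  ∧-anticomm u v ω (false ∷ s) = ∧-anticomm (tail u) (tail v) _ s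
  ∧-anticomm u v ω (true ∷ s)  = begin
    u₀ * y + -1# * (tail u ∧ (λ s → v₀ * ω (false ∷ s) + -1# * (tail v ∧ ω₁) s)) s
      ≈⟨ +-congˡ (*-congˡ (expand (tail u) v₀ (tail v ∧ ω₁))) ⟩
    u₀ * y + -1# * (v₀ * x + -1# * (tail u ∧ tail v ∧ ω₁) s)
      ≈⟨ +-congˡ (*-congˡ (+-congˡ (*-congˡ (∧-anticomm (tail u) (tail v) ω₁ s)))) ⟩
    u₀ * y + -1# * (v₀ * x + -1# * (-1# * z))
      -- Two extra signs on the first term turn the next step into an identity of commutative
      -- semirings.
      ≈⟨ +-congʳ (-1*-1*x≈x _) ⟨
    -1# * (-1# * (u₀ * y)) + -1# * (v₀ * x + -1# * (-1# * z))
      ≈⟨ solve 4 (λ a b z e → e :* (e :* a) :+ e :* (b :+ e :* (e :* z)) :=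
           e :* (b :+ e :* (a :+ e :* z))) refl _ _ z -1# ⟩
    -1# * (v₀ * x + -1# * (u₀ * y + -1# * z))
      ≈⟨ *-congˡ (+-congˡ (*-congˡ (expand (tail v) u₀ (tail u ∧ ω₁)))) ⟨
    -1# * (v₀ * x + -1# * (tail v ∧ (λ s → u₀ * ω (false ∷ s) + -1# * (tail u ∧ ω₁) s)) s) ∎
    where
    u₀ = u zero
    v₀ = v zero
    ω₁ = ω ∘ (true ∷_)
    x = (tail u ∧ (ω ∘ (false ∷_))) s
    y = (tail v ∧ (ω ∘ (false ∷_))) s
    z = (tail v ∧ tail u ∧ ω₁) s

    expand : ∀ w a η → (w ∧ (λ s → a * ω (false ∷ s) + -1# * η s)) s ≈
                       a * (w ∧ (ω ∘ (false ∷_))) s + -1# * (w ∧ η) s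
    expand w a η = trans (∧-linearʳ w _ -1# η s) (+-congʳ (∧-scaleʳ w a _ s))

  𝟏 : Form n
  𝟏 []          = 1#
  𝟏 (false ∷ s) = 𝟏 s
  𝟏 (true ∷ s)  = 0#

  -- The latest factor stands leftmost. Taking the factors from an infinite sequence makes the shift
  -- of columns simply `g ∘ suc`, and lets a cycle be expressed as an equation between two members.
  ⋀ : (ℕ → Vector Carrier n) → ℕ → Form n
  ⋀ g zero    = 𝟏
  ⋀ g (suc m) = g m ∧ ⋀ g m

  ⋀-cong : ∀ {g h : ℕ → Vector Carrier n} → (∀ j i → g j i ≈ h j i) → ∀ m → ⋀ g m ≋ ⋀ h m
  ⋀-cong g≈h zero    s = refl
  ⋀-cong g≈h (suc m) s = ∧-cong (g≈h m) (⋀-cong g≈h m) s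

  -- Bringing `g 0` from the right end to the left takes it past m factors, at one sign each.
  ⋀-rotate : ∀ (g : ℕ → Vector Carrier n) m →
             ⋀ g (suc m) ≋ λ s → -1# ^ m * (g 0 ∧ ⋀ (g ∘ suc) m) s
  ⋀-rotate g zero    s = sym (*-identityˡ _)
  ⋀-rotate g (suc m) s = begin
    (g (suc m) ∧ ⋀ g (suc m)) s
      ≈⟨ ∧-congʳ (g (suc m)) (⋀-rotate g m) s ⟩
    (g (suc m) ∧ (λ s → -1# ^ m * (g 0 ∧ ⋀ (g ∘ suc) m) s)) s
      ≈⟨ ∧-scaleʳ (g (suc m)) (-1# ^ m) _ s ⟩
    -1# ^ m * (g (suc m) ∧ g 0 ∧ ⋀ (g ∘ suc) m) s
      ≈⟨ *-congˡ (∧-anticomm (g (suc m)) (g 0) _ s) ⟩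
    -1# ^ m * (-1# * (g 0 ∧ ⋀ (g ∘ suc) (suc m)) s)
      ≈⟨ solve 3 (λ a e x → a :* (e :* x) := e :* a :* x) refl _ -1# _ ⟩
    -1# ^ suc m * (g 0 ∧ ⋀ (g ∘ suc) (suc m)) s ∎

  -- After the rotation `g 0` stands next to a copy of itself.
  first∧⋀≋0 : ∀ (g : ℕ → Vector Carrier n) m → g 0 ∧ ⋀ g (suc m) ≋ λ _ → 0#
  first∧⋀≋0 g m s = begin
    (g 0 ∧ ⋀ g (suc m)) s
      ≈⟨ ∧-congʳ (g 0) (⋀-rotate g m) s ⟩
    (g 0 ∧ (λ s → -1# ^ m * (g 0 ∧ ⋀ (g ∘ suc) m) s)) s
      ≈⟨ ∧-scaleʳ (g 0) (-1# ^ m) _ s ⟩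
    -1# ^ m * (g 0 ∧ g 0 ∧ ⋀ (g ∘ suc) m) s
      ≈⟨ *-congˡ (∧-nilpotent (g 0) _ s) ⟩
    -1# ^ m * 0#
      ≈⟨ zeroʳ _ ⟩
    0# ∎

  -- Every component is an integer polynomial in the entries. Applied to Frobenius, this will turn a
  -- power of the determinant into the determinant of shifted columns.
  ⋀-homo : ∀ {φ} → IsRingHomomorphism rawRing rawRing φ →
           ∀ (g : ℕ → Vector Carrier n) m s → φ (⋀ g m s) ≈ ⋀ (λ j → φ ∘ g j) m s
  ⋀-homo {φ = φ} φ-homo g m = ⋀-step m
    where
    open IsRingHomomorphism φ-homo

    𝟏-homo : ∀ (s : Vec Bool n) → φ (𝟏 s) ≈ 𝟏 s
    𝟏-homo []          = 1#-homo
    𝟏-homo (false ∷ s) = 𝟏-homo s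
    𝟏-homo (true ∷ s)  = 0#-homo

    ∧-homo : ∀ (v : Vector Carrier n) ω s → φ ((v ∧ ω) s) ≈ ((φ ∘ v) ∧ (φ ∘ ω)) s
    ∧-homo v ω []          = 0#-homo
    ∧-homo v ω (false ∷ s) = ∧-homo (tail v) _ s
    ∧-homo v ω (true ∷ s)  = trans (+-homo _ _) (+-cong (*-homo _ _)
      (trans (*-homo _ _) (*-cong (trans (-‿homo 1#) (-‿cong 1#-homo)) (∧-homo (tail v) _ s))))

    ⋀-step : ∀ m s → φ (⋀ g m s) ≈ ⋀ (λ j → φ ∘ g j) m s
    ⋀-step zero    s = 𝟏-homo s
    ⋀-step (suc m) s = trans (∧-homo (g m) _ s) (∧-congʳ (φ ∘ g m) (⋀-step m) s)

  ∏ : (ℕ → Carrier) → ℕ → Carrier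
  ∏ t zero    = 1#
  ∏ t (suc m) = t m * ∏ t m

  module Bidiagonal (g : ℕ → Vector Carrier n) (t : ℕ → Carrier) where
    g′ : ℕ → Vector Carrier n
    g′ j i = g j i + t j * g (suc j) i

    -- Only the correction in the last column survives. By induction, replacing the earlier `g′` by
    -- `g` changes the wedge by a multiple of a form with factor `g m`, which the leading `g m`
    -- annihilates.
    ⋀-bidiagonal : ∀ m → ⋀ g′ (suc m) ≋ λ s → ⋀ g (suc m) s + t m * (g (suc m) ∧ ⋀ g′ m) s
    ⋀-bidiagonal m s = trans (∧-linearˡ (g m) (g (suc m)) (t m) _ s) (+-congʳ (last m s))
      where
      last : ∀ m → g m ∧ ⋀ g′ m ≋ g m ∧ ⋀ g m
      last zero    s = refl
      last (suc m) s = begin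
        (g (suc m) ∧ ⋀ g′ (suc m)) s
          ≈⟨ ∧-congʳ (g (suc m)) (⋀-bidiagonal m) s ⟩
        (g (suc m) ∧ (λ s → ⋀ g (suc m) s + t m * (g (suc m) ∧ ⋀ g′ m) s)) s
          ≈⟨ ∧-linearʳ (g (suc m)) _ (t m) _ s ⟩
        (g (suc m) ∧ ⋀ g (suc m)) s + t m * (g (suc m) ∧ g (suc m) ∧ ⋀ g′ m) s
          ≈⟨ +-congˡ (trans (*-congˡ (∧-nilpotent (g (suc m)) _ s)) (zeroʳ _)) ⟩
        (g (suc m) ∧ ⋀ g (suc m)) s + 0#
          ≈⟨ +-identityʳ _ ⟩
        (g (suc m) ∧ ⋀ g (suc m)) s ∎

    -- A leading `g 0` annihilates the term with unshifted columns, so the last column must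
    -- contribute its correction. By induction every column does, each with its factor `t j`.
    first∧⋀-bidiagonal : ∀ m → g 0 ∧ ⋀ g′ m ≋ λ s → ∏ t m * (g 0 ∧ ⋀ (g ∘ suc) m) s
    first∧⋀-bidiagonal zero    s = sym (*-identityˡ _)
    first∧⋀-bidiagonal (suc m) s = begin
      (g 0 ∧ ⋀ g′ (suc m)) s
        ≈⟨ ∧-congʳ (g 0) (⋀-bidiagonal m) s ⟩
      (g 0 ∧ (λ s → ⋀ g (suc m) s + t m * (g (suc m) ∧ ⋀ g′ m) s)) s
        ≈⟨ ∧-linearʳ (g 0) _ (t m) _ s ⟩
      (g 0 ∧ ⋀ g (suc m)) s + t m * (g 0 ∧ g (suc m) ∧ ⋀ g′ m) s
        ≈⟨ +-cong (first∧⋀≋0 g m s) (*-congˡ (∧-anticomm (g 0) (g (suc m)) _ s)) ⟩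
      0# + t m * (-1# * (g (suc m) ∧ g 0 ∧ ⋀ g′ m) s)
        ≈⟨ +-identityˡ _ ⟩
      t m * (-1# * (g (suc m) ∧ g 0 ∧ ⋀ g′ m) s)
        ≈⟨ *-congˡ (*-congˡ (trans (∧-congʳ (g (suc m)) (first∧⋀-bidiagonal m) s)
             (∧-scaleʳ (g (suc m)) (∏ t m) _ s))) ⟩
      t m * (-1# * (∏ t m * (g (suc m) ∧ g 0 ∧ ⋀ (g ∘ suc) m) s))
        ≈⟨ solve 4 (λ t e p x → t :* (e :* (p :* x)) := t :* p :* (e :* x)) refl _ -1# _ _ ⟩
      ∏ t (suc m) * (-1# * (g (suc m) ∧ g 0 ∧ ⋀ (g ∘ suc) m) s)
        ≈⟨ *-congˡ (∧-anticomm (g 0) (g (suc m)) _ s) ⟨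
      ∏ t (suc m) * (g 0 ∧ g (suc m) ∧ ⋀ (g ∘ suc) m) s ∎

    -- When the columns close up into a cycle, the surviving correction begins with `g 0`. Hence
    -- only the two extreme choices remain: no column shifted, or all of them.
    ⋀-cyclic : ∀ m → (∀ i → g (suc m) i ≈ g 0 i) →
               ⋀ g′ (suc m) ≋ λ s → ⋀ g (suc m) s + ∏ t (suc m) * ⋀ (g ∘ suc) (suc m) s
    ⋀-cyclic m cyclic s = begin
      ⋀ g′ (suc m) s
        ≈⟨ ⋀-bidiagonal m s ⟩
      ⋀ g (suc m) s + t m * (g (suc m) ∧ ⋀ g′ m) s
        ≈⟨ +-congˡ (*-congˡ (∧-cong cyclic (λ _ → refl) s)) ⟩
      ⋀ g (suc m) s + t m * (g 0 ∧ ⋀ g′ m) s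
        ≈⟨ +-congˡ (*-congˡ (first∧⋀-bidiagonal m s)) ⟩
      ⋀ g (suc m) s + t m * (∏ t m * (g 0 ∧ ⋀ (g ∘ suc) m) s)
        ≈⟨ +-congˡ (*-assoc _ _ _) ⟨
      ⋀ g (suc m) s + ∏ t (suc m) * (g 0 ∧ ⋀ (g ∘ suc) m) s
        ≈⟨ +-congˡ (*-congˡ (∧-cong cyclic (λ _ → refl) s)) ⟨
      ⋀ g (suc m) s + ∏ t (suc m) * ⋀ (g ∘ suc) (suc m) s ∎

-- Polynomial functions and the number of their roots.

module Polynomial {c ℓ} (R : CommutativeRing c ℓ) where
  open CommutativeRing R hiding (zero)
  open import Algebra.Properties.Semiring.Exp semiring using (_^_)
  open import Algebra.Properties.Group +-group using () renaming (x∙y⁻¹≈ε⇒x≈y to x-y≈0⇒x≈y)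
  open import Algebra.Solver.Ring.NaturalCoefficients.Default commutativeSemiring
    using (solve; _:+_; _:*_; _:=_; con)
  open import Relation.Binary.Reasoning.Setoid setoid

  -- Poly D a h: the function h is x ↦ a x^D + lower order terms; a may vanish.
  Poly : ℕ → Carrier → (Carrier → Carrier) → Set (c ⊔ ℓ)
  Poly zero    a h = ∃ λ b → b ≈ a × ∀ x → h x ≈ b
  Poly (suc D) a h = ∃₂ λ b g → Poly D a g × ∀ x → h x ≈ b + x * g x

  private variable
    D : ℕ
    a b : Carrier
    g h : Carrier → Carrier

  Poly-cong : a ≈ b → (∀ x → g x ≈ h x) → Poly D a g → Poly D b h
  Poly-cong {D = zero}  a≈b g≈h (e , e≈a , eq)   = e , trans e≈a a≈b , λ x → trans (sym (g≈h x)) (eq x)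
  Poly-cong {D = suc D} a≈b g≈h (e , k , P , eq) =
    e , k , Poly-cong a≈b (λ _ → refl) P , λ x → trans (sym (g≈h x)) (eq x)

  Poly-+ : Poly D a g → Poly D b h → Poly D (a + b) (λ x → g x + h x)
  Poly-+ {D = zero} (e , e≈a , eq) (e′ , e′≈b , eq′) =
    e + e′ , +-cong e≈a e′≈b , λ x → +-cong (eq x) (eq′ x)
  Poly-+ {D = suc D} (e , k , P , eq) (e′ , k′ , P′ , eq′) =
    e + e′ , _ , Poly-+ P P′ , λ x → trans (+-cong (eq x) (eq′ x))
      (solve 5 (λ e x k e′ k′ → (e :+ x :* k) :+ (e′ :+ x :* k′) :=
        (e :+ e′) :+ x :* (k :+ k′)) refl e x (k x) e′ (k′ x))

  Poly-* : ∀ b → Poly D a h → Poly D (b * a) (λ x → b * h x)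
  Poly-* {D = zero}  b (e , e≈a , eq)   = b * e , *-congˡ e≈a , λ x → *-congˡ (eq x)
  Poly-* {D = suc D} b (e , k , P , eq) = b * e , _ , Poly-* b P , λ x → trans (*-congˡ (eq x))
    (solve 4 (λ b e x k → b :* (e :+ x :* k) := b :* e :+ x :* (b :* k)) refl b e x (k x))

  Poly-^ : ∀ D → Poly D 1# (_^ D)
  Poly-^ zero    = 1# , refl , λ _ → refl
  Poly-^ (suc D) = 0# , _ , Poly-^ D , λ x → sym (+-identityˡ _)

  Poly-suc : Poly D a h → Poly (suc D) 0# h
  Poly-suc {D = zero} (e , e≈a , eq) = e , (λ _ → 0#) , (0# , refl , λ _ → refl) ,
    λ x → trans (eq x) (sym (trans (+-congˡ (zeroʳ x)) (+-identityʳ e)))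
  Poly-suc {D = suc D} (e , k , P , eq) = e , k , Poly-suc P , eq

  Poly-raise : ∀ {D′} → Poly D a h → D ℕ.< D′ → Poly D′ 0# h
  Poly-raise {D = D} P D<D′ = go (Poly-suc P) (ℕ.≤⇒≤′ D<D′)
    where
    go : ∀ {D₁ D₂ h} → Poly D₁ 0# h → D₁ ≤′ D₂ → Poly D₂ 0# h
    go P (≤′-reflexive ≡.refl) = P
    go P (≤′-step le)            = Poly-suc (go P le)

  Poly-0 : ∀ D → Poly D 0# (λ _ → 0#)
  Poly-0 D = Poly-cong (zeroˡ _) (λ _ → zeroˡ _) (Poly-* 0# (Poly-^ D))

  private
    x≈r+[x-r] : ∀ x r → x ≈ r + (x - r)
    x≈r+[x-r] x r = begin
      x             ≈⟨ +-identityʳ x ⟨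
      x + 0#        ≈⟨ +-congˡ (-‿inverseˡ r) ⟨
      x + (- r + r) ≈⟨ solve 3 (λ x r r′ → x :+ (r′ :+ r) := r :+ (x :+ r′)) refl x r (- r) ⟩
      r + (x - r)   ∎

  -- Horner's scheme: if k₁ is the quotient of k by x - r, then k r + x k₁ x is the quotient of e +
  -- x k x. The leading coefficient is kept, so that the root count can recurse.
  Poly-factor : Poly (suc D) a h → ∀ r →
                ∃ λ k → Poly D a k × ∀ x → h x ≈ h r + (x - r) * k x
  Poly-factor {D = zero} {h = h} (e , k , (b , b≈a , k≈b) , eq) r =
    (λ _ → b) , (b , b≈a , λ _ → refl) , λ x → begin
      h x                          ≈⟨ eq x ⟩
      e + x * k x                  ≈⟨ +-congˡ (*-cong (x≈r+[x-r] x r) (k≈b x)) ⟩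
      e + (r + (x - r)) * b        ≈⟨ solve 4 (λ e r y b → e :+ (r :+ y) :* b :=
                                        (e :+ r :* b) :+ y :* b) refl e r (x - r) b ⟩
      (e + r * b) + (x - r) * b    ≈⟨ +-congʳ (+-congˡ (*-congˡ (k≈b r))) ⟨
      (e + r * k r) + (x - r) * b  ≈⟨ +-congʳ (eq r) ⟨
      h r + (x - r) * b            ∎
  Poly-factor {D = suc D} {h = h} (e , k , P , eq) r =
    let k₁ , P₁ , eq₁ = Poly-factor P r in
    (λ x → k r + x * k₁ x) , (k r , k₁ , P₁ , λ _ → refl) , λ x → begin
      h x
        ≈⟨ eq x ⟩
      e + x * k x
        ≈⟨ +-congˡ (*-congˡ (eq₁ x)) ⟩
      e + x * (k r + (x - r) * k₁ x)
        ≈⟨ +-congˡ (distribˡ x _ _) ⟩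
      e + (x * k r + x * ((x - r) * k₁ x))
        ≈⟨ +-congˡ (+-congʳ (*-congʳ (x≈r+[x-r] x r))) ⟩
      e + ((r + (x - r)) * k r + x * ((x - r) * k₁ x))
        ≈⟨ solve 6 (λ e r y kr x k₁ → e :+ ((r :+ y) :* kr :+ x :* (y :* k₁)) :=
             (e :+ r :* kr) :+ y :* (kr :+ x :* k₁)) refl e r (x - r) (k r) x (k₁ x) ⟩
      (e + r * k r) + (x - r) * (k r + x * k₁ x)
        ≈⟨ +-congʳ (eq r) ⟨
      h r + (x - r) * (k r + x * k₁ x) ∎

  -- One root splits off a linear factor. In a domain all other roots are roots of the quotient,
  -- which has smaller degree and the same nonzero leading coefficient.
  roots≤degree : (∀ {x y} → x * y ≈ 0# → x ≈ 0# ⊎ y ≈ 0#) →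
                 Poly D a h → ¬ a ≈ 0# → ∀ {xs} →
                 AllPairs (λ x y → ¬ x ≈ y) xs → All (λ x → h x ≈ 0#) xs → length xs ℕ.≤ D
  roots≤degree domain P a≉0 [] [] = z≤n
  roots≤degree {D = zero} domain (b , b≈a , h≈b) a≉0 (_ ∷ _) (hx≈0 ∷ _) =
    contradiction (trans (sym b≈a) (trans (sym (h≈b _)) hx≈0)) a≉0
  roots≤degree {D = suc D} {h = h} domain P a≉0 {r ∷ xs} (r≉ ∷ distinct) (hr≈0 ∷ roots) =
    let k , Q , eq = Poly-factor P r in
    s≤s (roots≤degree domain Q a≉0 distinct
      (All.zipWith (λ {x} (r≉x , hx≈0) →
          [ (λ x-r≈0 → contradiction (sym (x-y≈0⇒x≈y _ _ x-r≈0)) r≉x) , id ]′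
        (domain (begin
          (x - r) * k x        ≈⟨ +-identityˡ _ ⟨
          0# + (x - r) * k x   ≈⟨ +-congʳ hr≈0 ⟨
          h r + (x - r) * k x  ≈⟨ eq x ⟨
          h x                  ≈⟨ hx≈0 ⟩
          0#                   ∎))) (r≉ , roots)))

-- The Moore determinant as a polynomial in its first variable.

module Moore {c ℓ} (R : CommutativeRing c ℓ) (p : ℕ) (1<p : 1 ℕ.< p) where
  open CommutativeRing R hiding (zero)
  open RingLemmas R
  open Exterior R
  open Polynomial R
  open import Algebra.Properties.Semiring.Exp semiring using (_^_; ^-congˡ)
  open import Relation.Binary.Reasoning.Setoid setoid

  private variable
    n : ℕ

  columns : Vector Carrier n → ℕ → Vector Carrier n
  columns x j i = x i ^ (p ^ℕ j)

  -- The coefficient at the full subset is the determinant, up to sign.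
  moore : Vector Carrier n → Carrier
  moore {n} x = ⋀ (columns x) n (replicate n true)

  moore-cong : ∀ {x y : Vector Carrier n} → (∀ i → x i ≈ y i) → moore x ≈ moore y
  moore-cong {n} x≈y = ⋀-cong (λ j i → ^-congˡ (p ^ℕ j) (x≈y i)) n _

  private
    -- `Poly D 0#` expresses degree below D. The bound persists because v does not depend on the
    -- variable.
    ∧-Poly : ∀ {D} (v : Vector Carrier n) (ω : Carrier → Form n) →
             (∀ s → Poly D 0# (λ a → ω a s)) → ∀ s → Poly D 0# (λ a → (v ∧ ω a) s)
    ∧-Poly v ω P []          = Poly-0 _
    ∧-Poly v ω P (false ∷ s) = ∧-Poly (tail v) _ (P ∘ (false ∷_)) s
    ∧-Poly v ω P (true ∷ s)  = Poly-cong (trans (+-cong (zeroʳ _) (zeroʳ _)) (+-identityˡ _)) (λ _ → refl)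
      (Poly-+ (Poly-* (v zero) (P (false ∷ s))) (Poly-* -1# (∧-Poly (tail v) _ (P ∘ (true ∷_)) s)))

    module _ (x : Vector Carrier n) where
      -- The variable a enters only the first coordinate, which these components avoid.
      ⋀-false : ∀ a m s → ⋀ (columns (a ⊹ x)) m (false ∷ s) ≈ ⋀ (columns x) m s
      ⋀-false a zero    s = refl
      ⋀-false a (suc m) s = ∧-congʳ (columns x m) (⋀-false a m) s

      -- Expansion along the first coordinate: the last column supplies a ^ (p ^ m) times a minor
      -- free of a. In the other term an earlier column supplies a smaller power, whence the mutual
      -- induction with `⋀-true`.
      ⋀-true-last : ∀ m s → Poly (p ^ℕ m) (⋀ (columns x) m s)
                      (λ a → ⋀ (columns (a ⊹ x)) (suc m) (true ∷ s))

      ⋀-true : ∀ m s → Poly (p ^ℕ m) 0# (λ a → ⋀ (columns (a ⊹ x)) m (true ∷ s))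
      ⋀-true zero    s = Poly-0 1
      ⋀-true (suc m) s = Poly-raise (⋀-true-last m s) (ℕ.^-monoʳ-< p 1<p (ℕ.n<1+n m))

      ⋀-true-last m s = Poly-cong
        (trans (+-cong (*-identityʳ _) (zeroʳ _)) (+-identityʳ _))
        (λ a → +-congʳ (trans (*-congʳ (sym (⋀-false a m s))) (*-comm _ _)))
        (Poly-+ (Poly-* (⋀ (columns x) m s) (Poly-^ (p ^ℕ m)))
                (Poly-* -1# (∧-Poly (columns x m) _ (⋀-true m) s)))

  moore-Poly : ∀ (x : Vector Carrier n) → Poly (p ^ℕ n) (moore x) (λ a → moore (a ⊹ x))
  moore-Poly {n} x = ⋀-true-last x n _

-- The Frobenius endomorphism in characteristic p.

module Frobenius {c ℓ} (R : CommutativeRing c ℓ) {p : ℕ} (p-prime : Prime p)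
  (p·1≈0 : RingLemmas.CharacteristicDivides R p) where
  open CommutativeRing R hiding (zero)
  open import Algebra.Properties.Group +-group using (inverseʳ-unique; identityʳ-unique)
  open import Algebra.Properties.Semiring.Exp semiring using (_^_; ^-congˡ; ^-assocʳ)
  open import Algebra.Properties.Semiring.Mult semiring
    using (×-assoc-*; ×-assocˡ; ×-congʳ; ×-congˡ) renaming (_×_ to _·_)
  open import Algebra.Properties.CommutativeSemiring.Exp commutativeSemiring using (^-distrib-*)
  open import Algebra.Properties.CommutativeMonoid.Sum +-commutativeMonoid
    using (sum; sum-cong-≋; sum-replicate-zero; sum-init-last)
  open import Algebra.Properties.CommutativeSemiring.Binomial commutativeSemiring using (theorem; binomialTerm)
  open import Relation.Binary.Reasoning.Setoid setoid

  p·x≈0 : ∀ x → p · x ≈ 0#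
  p·x≈0 x = begin
    p · x          ≈⟨ ×-congʳ p (*-identityˡ x) ⟨
    p · (1# * x)   ≈⟨ ×-assoc-* p 1# x ⟨
    (p · 1#) * x   ≈⟨ *-congʳ p·1≈0 ⟩
    0# * x         ≈⟨ zeroˡ x ⟩
    0#             ∎

  ∣⇒·≈0 : ∀ {n} → p ∣ n → ∀ x → n · x ≈ 0#
  ∣⇒·≈0 (divides m ≡.refl) x = begin
    (m ℕ.* p) · x  ≈⟨ ×-congˡ {x} (ℕ.*-comm m p) ⟩
    (p ℕ.* m) · x  ≈⟨ ×-assocˡ x p m ⟨
    p · (m · x)    ≈⟨ p·x≈0 _ ⟩
    0#             ∎

  ^p-+ : ∀ x y → (x + y) ^ p ≈ x ^ p + y ^ p
  ^p-+ x y = go p ≡.refl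
    where
    -- The exponent is generalised so that it can be matched as a successor, which exposes the first
    -- and last binomial terms. The inner ones vanish by `p∣pCk`.
    go : ∀ n → n ≡ p → (x + y) ^ n ≈ x ^ n + y ^ n
    go zero    ≡.refl = contradiction p-prime ¬prime[0]
    go (suc m) ≡.refl = begin
      (x + y) ^ suc m
        ≈⟨ theorem (suc m) x y ⟩
      term zero + sum (term ∘ suc)
        ≈⟨ +-congˡ (sum-init-last (term ∘ suc)) ⟩
      term zero + (sum (term ∘ suc ∘ inject₁) + term (suc (fromℕ m)))
        ≈⟨ +-cong (trans (+-identityʳ _) (*-identityˡ _)) (+-cong middle last) ⟩
      y ^ suc m + (0# + x ^ suc m)
        ≈⟨ +-congˡ (+-identityˡ _) ⟩
      y ^ suc m + x ^ suc m
        ≈⟨ +-comm _ _ ⟩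
      x ^ suc m + y ^ suc m ∎
      where
      term : Fin (suc (suc m)) → Carrier
      term = binomialTerm x y (suc m)

      middle : sum (term ∘ suc ∘ inject₁) ≈ 0#
      middle = trans (sum-cong-≋ λ i → ∣⇒·≈0 (NaturalArithmetic.p∣pCk p-prime z<s
        (s≤s (≡.subst (ℕ._< m) (≡.sym (toℕ-inject₁ i)) (toℕ<n i)))) _) (sum-replicate-zero m)

      last : term (suc (fromℕ m)) ≈ x ^ suc m
      last = begin
        term (suc (fromℕ m))
          ≡⟨ ≡.cong (λ k → (suc m C suc k) · (x ^ suc k * y ^ (m ∸ k))) (toℕ-fromℕ m) ⟩
        (suc m C suc m) · (x ^ suc m * y ^ (m ∸ m))
          ≡⟨ ≡.cong₂ (λ k l → k · (x ^ suc m * y ^ l)) (nCn≡1 (suc m)) (ℕ.n∸n≡0 m) ⟩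
        1 · (x ^ suc m * 1#)
          ≈⟨ trans (+-identityʳ _) (*-identityʳ _) ⟩
        x ^ suc m ∎

  ^p^-suc : ∀ x j → (x ^ (p ^ℕ j)) ^ p ≈ x ^ (p ^ℕ suc j)
  ^p^-suc x j = trans (^-assocʳ x (p ^ℕ j) p) (reflexive (≡.cong (x ^_) (ℕ.*-comm (p ^ℕ j) p)))

  ^p^-+ : ∀ x y j → (x + y) ^ (p ^ℕ j) ≈ x ^ (p ^ℕ j) + y ^ (p ^ℕ j)
  ^p^-+ x y zero    = trans (*-identityʳ _) (sym (+-cong (*-identityʳ x) (*-identityʳ y)))
  ^p^-+ x y (suc j) = begin
    (x + y) ^ (p ^ℕ suc j)                    ≈⟨ ^p^-suc (x + y) j ⟨
    ((x + y) ^ (p ^ℕ j)) ^ p                  ≈⟨ ^-congˡ p (^p^-+ x y j) ⟩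
    (x ^ (p ^ℕ j) + y ^ (p ^ℕ j)) ^ p         ≈⟨ ^p-+ _ _ ⟩
    (x ^ (p ^ℕ j)) ^ p + (y ^ (p ^ℕ j)) ^ p   ≈⟨ +-cong (^p^-suc x j) (^p^-suc y j) ⟩
    x ^ (p ^ℕ suc j) + y ^ (p ^ℕ suc j)       ∎

  ^p-isRingHomomorphism : IsRingHomomorphism rawRing rawRing (_^ p)
  ^p-isRingHomomorphism = record
    { isSemiringHomomorphism = record
      { isNearSemiringHomomorphism = record
        { +-isMonoidHomomorphism = record
          { isMagmaHomomorphism = record
            { isRelHomomorphism = record { cong = ^-congˡ p }
            ; homo = ^p-+ }
          ; ε-homo = 0^p≈0 }
        ; *-homo = λ x y → ^-distrib-* x y p }
      ; 1#-homo = 1^n≈1 p }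
    -- Additivity makes (- x) ^ p the additive inverse of x ^ p, for even and odd p alike.
    ; -‿homo = λ x → inverseʳ-unique (x ^ p) ((- x) ^ p)
        (trans (sym (^p-+ x (- x))) (trans (^-congˡ p (-‿inverseʳ x)) 0^p≈0)) }
    where
    0^p≈0 : 0# ^ p ≈ 0#
    0^p≈0 = identityʳ-unique (0# ^ p) (0# ^ p)
      (trans (sym (^p-+ 0# 0#)) (^-congˡ p (+-identityʳ 0#)))

    1^n≈1 : ∀ n → 1# ^ n ≈ 1#
    1^n≈1 zero    = refl
    1^n≈1 (suc n) = trans (*-identityˡ _) (1^n≈1 n)

-- Finite fields: decidability, cancellation, characteristic and Fermat's theorem.

module FiniteFieldProperties {c ℓ₁ ℓ₂ q} (F : FiniteField c ℓ₁ ℓ₂ q) where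
  open FiniteField F hiding (zero)

  commutativeRing : CommutativeRing c ℓ₁
  commutativeRing = record { isCommutativeRing = isCommutativeRing }

  open CommutativeRing commutativeRing
    using (semiring; *-commutativeMonoid; +-commutativeMonoid; +-group)
  open import Algebra.Properties.Semiring.Exp semiring using (_^_) public
  open import Algebra.Properties.Semiring.Mult semiring using (×1-homo-*) renaming (_×_ to _·_)
  open import Algebra.Properties.Group +-group using (identityʳ-unique; ε⁻¹≈ε)
  module Σ = CommutativeMonoidSum +-commutativeMonoid
  -- The sum of the multiplicative monoid, so `Π.sum` is a product.
  module Π = CommutativeMonoidSum *-commutativeMonoid
  open import Relation.Binary.Reasoning.Setoid setoid

  open Inverse enumeration public using () renaming (to to code; from to decode; to-cong to code-cong)

  code∘decode : ∀ i → code (decode i) ≡ i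
  code∘decode i = Inverse.inverseˡ enumeration refl

  decode∘code : ∀ x → decode (code x) ≈ x
  decode∘code x = Inverse.inverseʳ enumeration ≡.refl

  infix 4 _≈?_
  _≈?_ : ∀ x y → Dec (x ≈ y)
  x ≈? y = map′
    (λ eq → trans (sym (decode∘code x)) (trans (reflexive (≡.cong decode eq)) (decode∘code y)))
    code-cong (code x ≟ code y)

  -- If 1 were 0, then 1 - 0 would be invertible, which makes 1 apart from 0 against irreflexivity.
  1≉0 : ¬ 1# ≈ 0#
  1≉0 1≈0 = #-irrefl 1≈0 (invertible⇒# (1# , inverse , trans (*-comm _ _) inverse))
    where
    inverse : 1# * (1# - 0#) ≈ 1#
    inverse = begin
      1# * (1# + - 0#)        ≈⟨ *-identityˡ _ ⟩
      1# + - 0#               ≈⟨ +-congʳ 1≈0 ⟩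
      0# + - 0#               ≈⟨ -‿inverseʳ 0# ⟩
      0#                      ≈⟨ 1≈0 ⟨
      1#                      ∎

  -- The field axioms give inverses of nonzero elements only up to double negation, which
  -- is enough to prove decidable statements.
  with-inverse : ∀ {p} {P : Set p} {x} → ¬ x ≈ 0# → Dec P →
                 (∀ x⁻¹ → x⁻¹ * x ≈ 1# → P) → P
  with-inverse {x = x} x≉0 P? f = decidable-stable P? λ ¬P →
    x≉0 (proj₁ (tight x 0#) λ x#0 →
      let x⁻¹ , x⁻¹x≈1 , _ = #⇒invertible x#0 in
      ¬P (f x⁻¹ (trans (*-congˡ (sym (trans (+-congˡ ε⁻¹≈ε) (+-identityʳ x)))) x⁻¹x≈1)))

  *-cancelˡ-nonzero : ∀ {x y z} → ¬ x ≈ 0# → x * y ≈ x * z → y ≈ z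
  *-cancelˡ-nonzero {x} {y} {z} x≉0 xy≈xz = with-inverse x≉0 (y ≈? z) λ x⁻¹ x⁻¹x≈1 →
    let cancel : ∀ w → x⁻¹ * (x * w) ≈ w
        cancel w = trans (sym (*-assoc _ _ _)) (trans (*-congʳ x⁻¹x≈1) (*-identityˡ w))
    in trans (sym (cancel y)) (trans (*-congˡ xy≈xz) (cancel z))

  x*y≈0⇒x≈0⊎y≈0 : ∀ {x y} → x * y ≈ 0# → x ≈ 0# ⊎ y ≈ 0#
  x*y≈0⇒x≈0⊎y≈0 {x} xy≈0 with x ≈? 0#
  ... | yes x≈0 = inj₁ x≈0
  ... | no  x≉0 = inj₂ (*-cancelˡ-nonzero x≉0 (trans xy≈0 (sym (zeroʳ x))))

  x^n≈0⇒x≈0 : ∀ {x} n → x ^ n ≈ 0# → x ≈ 0#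
  x^n≈0⇒x≈0 zero    1≈0   = contradiction 1≈0 1≉0
  x^n≈0⇒x≈0 (suc n) xxⁿ≈0 = [ id , x^n≈0⇒x≈0 n ]′ (x*y≈0⇒x≈0⊎y≈0 xxⁿ≈0)

  -- Translation by 1 permutes the field, so the sum of all elements is unchanged when q · 1 is
  -- added to it.
  q·1≈0 : q · 1# ≈ 0#
  q·1≈0 = identityʳ-unique (Σ.sum decode) (q · 1#) (sym (begin
    Σ.sum decode                          ≈⟨ Σ.sum-permute decode translation ⟩
    Σ.sum (λ i → decode (shift 1# i))     ≈⟨ Σ.sum-cong-≋ {q} (λ i → decode∘code _) ⟩
    Σ.sum (λ i → decode i + 1#)           ≈⟨ Σ.∑-distrib-+ decode (λ _ → 1#) ⟩
    Σ.sum decode + Σ.sum {q} (λ _ → 1#)   ≈⟨ +-congˡ (Σ.sum-replicate q) ⟩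
    Σ.sum decode + q · 1#                 ∎))
    where
    shift : Carrier → Fin q → Fin q
    shift a i = code (decode i + a)

    shift-shift : ∀ a b → a + b ≈ 0# → ∀ i → shift b (shift a i) ≡ i
    shift-shift a b a+b≈0 i = ≡.trans (code-cong (begin
      decode (code (decode i + a)) + b  ≈⟨ +-congʳ (decode∘code _) ⟩
      decode i + a + b                  ≈⟨ +-assoc _ _ _ ⟩
      decode i + (a + b)                ≈⟨ +-congˡ a+b≈0 ⟩
      decode i + 0#                     ≈⟨ +-identityʳ _ ⟩
      decode i                          ∎)) (code∘decode i)

    translation : Permutation′ q
    translation = permutation (shift 1#) (shift (- 1#))
      (shift-shift (- 1#) 1# (-‿inverseˡ 1#)) (shift-shift 1# (- 1#) (-‿inverseʳ 1#))

  -- Here q · 1 is the k-th power of p · 1, and a field has no nonzero nilpotents.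
  prime-power·1≈0 : ∀ {p} k → q ≡ p ^ℕ k → p · 1# ≈ 0#
  prime-power·1≈0 {p} k ≡.refl = x^n≈0⇒x≈0 k (trans (sym (homo k)) q·1≈0)
    where
    homo : ∀ k → (p ^ℕ k) · 1# ≈ (p · 1#) ^ k
    homo zero    = +-identityʳ 1#
    homo (suc k) = trans (×1-homo-* p (p ^ℕ k)) (*-congˡ (homo k))

  product≉0 : ∀ {n} (f : Vector Carrier n) → (∀ i → ¬ f i ≈ 0#) → ¬ Π.sum f ≈ 0#
  product≉0 {zero}  f f≉0 = 1≉0
  product≉0 {suc n} f f≉0 = [ f≉0 zero , product≉0 (tail f) (f≉0 ∘ suc) ]′ ∘ x*y≈0⇒x≈0⊎y≈0

-- Multiplication by a nonzero element permutes the nonzero elements.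
fermat : ∀ {c ℓ₁ ℓ₂ q} (F : FiniteField c ℓ₁ ℓ₂ q) →
         ∀ a → FiniteField._≈_ F (FiniteFieldProperties._^_ F a q) a
fermat {q = zero} F a = contradiction (FiniteFieldProperties.code F a) λ ()
fermat {q = suc m} F a = [ zero-case , nonzero-case ]′ (toSum (a ≈? 0#))
  where
  open FiniteField F hiding (zero)
  open FiniteFieldProperties F
  open import Relation.Binary.Reasoning.Setoid setoid

  zero-case : a ≈ 0# → a ^ suc m ≈ a
  zero-case a≈0 = trans (*-congʳ a≈0) (trans (zeroˡ _) (sym a≈0))

  i₀ : Fin (suc m)
  i₀ = code 0#

  nonzeros : Fin m → Carrier
  nonzeros j = decode (punchIn i₀ j)

  nonzeros≉0 : ∀ j → ¬ nonzeros j ≈ 0#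
  nonzeros≉0 j eq = punchInᵢ≢i i₀ j (≡.trans (≡.sym (code∘decode _)) (code-cong eq))

  nonzero-case : ¬ a ≈ 0# → a ^ suc m ≈ a
  nonzero-case a≉0 = with-inverse a≉0 (a ^ suc m ≈? a) λ a⁻¹ a⁻¹a≈1 →
    let
      scale : Carrier → Fin (suc m) → Fin (suc m)
      scale b i = code (b * decode i)

      scale-scale : ∀ b d → b * d ≈ 1# → ∀ i → scale b (scale d i) ≡ i
      scale-scale b d bd≈1 i = ≡.trans (code-cong (begin
        b * decode (code (d * decode i))  ≈⟨ *-congˡ (decode∘code _) ⟩
        b * (d * decode i)                ≈⟨ *-assoc _ _ _ ⟨
        b * d * decode i                  ≈⟨ *-congʳ bd≈1 ⟩
        1# * decode i                     ≈⟨ *-identityˡ _ ⟩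
        decode i                          ∎)) (code∘decode i)

      π : Permutation′ (suc m)
      π = permutation (scale a) (scale a⁻¹)
        (scale-scale a a⁻¹ (trans (*-comm _ _) a⁻¹a≈1)) (scale-scale a⁻¹ a a⁻¹a≈1)

      π-fixes-i₀ : π ⟨$⟩ʳ i₀ ≡ i₀
      π-fixes-i₀ = code-cong (trans (*-congˡ (decode∘code 0#)) (zeroʳ a))

      -- As the permutation fixes the index of zero, removing that index leaves a permutation of the
      -- nonzero elements.
      permuted : ∀ j → nonzeros (remove i₀ π ⟨$⟩ʳ j) ≈ a * nonzeros j
      permuted j = begin
        decode (punchIn i₀ (remove i₀ π ⟨$⟩ʳ j))
          ≡⟨ ≡.cong (λ i → decode (punchIn i (remove i₀ π ⟨$⟩ʳ j))) π-fixes-i₀ ⟨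
        decode (punchIn (π ⟨$⟩ʳ i₀) (remove i₀ π ⟨$⟩ʳ j))
          ≡⟨ ≡.cong decode (punchIn-permute π i₀ j) ⟨
        decode (scale a (punchIn i₀ j))
          ≈⟨ decode∘code _ ⟩
        a * nonzeros j ∎

      -- Compare the product of all nonzero elements before and after scaling each by a, then cancel
      -- it.
      aᵐ≈1 : a ^ m ≈ 1#
      aᵐ≈1 = *-cancelˡ-nonzero (product≉0 nonzeros nonzeros≉0) (begin
        Π.sum nonzeros * a ^ m
          ≈⟨ *-comm _ _ ⟩
        a ^ m * Π.sum nonzeros
          ≈⟨ *-congʳ (Π.sum-replicate m) ⟨
        Π.sum {m} (λ _ → a) * Π.sum nonzeros
          ≈⟨ Π.∑-distrib-+ {m} (λ _ → a) nonzeros ⟨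
        Π.sum (λ j → a * nonzeros j)
          ≈⟨ Π.sum-cong-≋ {m} permuted ⟨
        Π.sum (λ j → nonzeros (remove i₀ π ⟨$⟩ʳ j))
          ≈⟨ Π.sum-permute nonzeros (remove i₀ π) ⟨
        Π.sum nonzeros
          ≈⟨ *-identityʳ _ ⟨
        Π.sum nonzeros * 1# ∎)
    in trans (*-congˡ aᵐ≈1) (*-identityʳ a)

-- The Moore determinant along lines in the Frobenius direction.

module MooreMatching {c ℓ₁ ℓ₂} {p} (p-prime : Prime p) (k-1 : ℕ)
                     (F : FiniteField c ℓ₁ ℓ₂ (p ^ℕ suc k-1)) where
  private
    q = p ^ℕ suc k-1
    k = suc k-1

    1<p : 1 ℕ.< p
    1<p = NaturalArithmetic.prime⇒1<p p-prime

  open NaturalArithmetic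
  open ListCounting
  open FiniteFieldProperties F
  open CommutativeRing commutativeRing hiding (zero)
  open RingLemmas commutativeRing
  open Exterior commutativeRing hiding (_≋_)
  open Polynomial commutativeRing
  open Moore commutativeRing p 1<p
  open Frobenius commutativeRing p-prime (prime-power·1≈0 {p} k ≡.refl)
  open import Algebra.Properties.Semiring.Exp semiring using (^-congˡ; ^-assocʳ)
  open import Algebra.Properties.CommutativeSemiring.Exp commutativeSemiring using (^-distrib-*)
  open import Algebra.Properties.Group +-group using (identityʳ-unique)
  open import Relation.Binary.Reasoning.Setoid setoid

  private variable
    n : ℕ

  moore^p : ∀ (x : Vector Carrier n) → moore x ^ p ≈ ⋀ (columns x ∘ suc) n (replicate n true)
  moore^p {n} x = trans (⋀-homo ^p-isRingHomomorphism (columns x) n _)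
    (⋀-cong (λ j i → ^p^-suc (x i) j) n _)

  columns-cyclic : ∀ (x : Vector Carrier n) i → columns x k i ≈ columns x 0 i
  columns-cyclic x i = trans (fermat F (x i)) (sym (*-identityʳ (x i)))

  -- The p-th power shifts every column by one. Column k equals column 0, so what remains is the
  -- sign of a rotation of k columns.
  moore-sign : ∀ (x : Vector Carrier k) → -1# ^ k-1 * moore x ^ p ≈ moore x
  moore-sign x = begin
    -1# ^ k-1 * moore x ^ p
      ≈⟨ *-congˡ (moore^p x) ⟩
    -1# ^ k-1 * ⋀ (columns x ∘ suc) k (replicate k true)
      ≈⟨ *-congˡ (∧-cong {ω = ⋀ (columns x ∘ suc) k-1} (columns-cyclic x) (λ _ → refl)
           (replicate k true)) ⟩
    -1# ^ k-1 * (columns x 0 ∧ ⋀ (columns x ∘ suc) k-1) (replicate k true)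
      ≈⟨ ⋀-rotate (columns x) k-1 (replicate k true) ⟨
    moore x ∎

  frobeniusLine : Vector Carrier n → Carrier → Vector Carrier n
  frobeniusLine x t i = x i + t * x i ^ p

  private
    conjugates : Carrier → ℕ → Carrier
    conjugates t j = t ^ (p ^ℕ j)

    -- The field norm from 𝔽_q down to 𝔽_p.
    norm : Carrier → Carrier
    norm t = ∏ (conjugates t) k

    norm≈0⇒≈0 : ∀ {t} → norm t ≈ 0# → t ≈ 0#
    norm≈0⇒≈0 {t} = go k
      where
      go : ∀ m → ∏ (conjugates t) m ≈ 0# → t ≈ 0#
      go zero    1≈0 = contradiction 1≈0 1≉0
      go (suc m)     = [ x^n≈0⇒x≈0 (p ^ℕ m) , go m ]′ ∘ x*y≈0⇒x≈0⊎y≈0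

  -- Additivity of Frobenius brings the columns at the moved point into the bidiagonal form, with
  -- the conjugates of t as weights.
  moore-frobeniusLine : ∀ (x : Vector Carrier k) t →
                        moore (frobeniusLine x t) ≈ moore x + norm t * moore x ^ p
  moore-frobeniusLine x t = begin
    moore (frobeniusLine x t)
      ≈⟨ ⋀-cong columns-line k (replicate k true) ⟩
    ⋀ g′ k (replicate k true)
      ≈⟨ ⋀-cyclic k-1 (columns-cyclic x) (replicate k true) ⟩
    moore x + norm t * ⋀ (columns x ∘ suc) k (replicate k true)
      ≈⟨ +-congˡ (*-congˡ (moore^p x)) ⟨
    moore x + norm t * moore x ^ p ∎
    where
    open Bidiagonal (columns x) (conjugates t)

    columns-line : ∀ j i → columns (frobeniusLine x t) j i ≈ g′ j i
    columns-line j i = trans (^p^-+ _ _ j)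
      (+-congˡ (trans (^-distrib-* t (x i ^ p) (p ^ℕ j)) (*-congˡ (^-assocʳ (x i) p (p ^ℕ j)))))

  -- Equal values force `norm t * moore x ^ p` to vanish, and its second factor is nonzero.
  frobeniusLine-tangent : ∀ {x : Vector Carrier k} → ¬ moore x ≈ 0# → ∀ {t} →
                          moore (frobeniusLine x t) ≈ moore x → t ≈ 0#
  frobeniusLine-tangent {x} moore≉0 {t} eq =
    [ norm≈0⇒≈0 , (λ moore^p≈0 → contradiction (x^n≈0⇒x≈0 p moore^p≈0) moore≉0) ]′
      (x*y≈0⇒x≈0⊎y≈0 (identityʳ-unique (moore x) _ (trans (sym (moore-frobeniusLine x t)) eq)))

  -- Counting nonsingular vectors and choosing a large level set.

  ⟦_⟧ : Vec (Fin q) n → Vector Carrier n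
  ⟦ [] ⟧    = λ ()
  ⟦ a ∷ v ⟧ = decode a ⊹ ⟦ v ⟧

  decode-injective : ∀ {a b} → decode a ≈ decode b → a ≡ b
  decode-injective eq = ≡.trans (≡.sym (code∘decode _)) (≡.trans (code-cong eq) (code∘decode _))

  -- Codes are unique representatives, so distinct vectors can be counted in lists with
  -- propositional equality.
  ⟦⟧-injective : ∀ (v w : Vec (Fin q) n) → (∀ i → ⟦ v ⟧ i ≈ ⟦ w ⟧ i) → v ≡ w
  ⟦⟧-injective []      []      eq = ≡.refl
  ⟦⟧-injective (a ∷ v) (b ∷ w) eq =
    ≡.cong₂ _∷_ (decode-injective (eq zero)) (⟦⟧-injective v w (eq ∘ suc))

  roots : (Carrier → Carrier) → List (Fin q)
  roots h = filter (λ a → h (decode a) ≈? 0#) (allFin q)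

  length-roots : ∀ {D a h} → Poly D a h → ¬ a ≈ 0# → length (roots h) ℕ.≤ D
  length-roots {h = h} P a≉0 = ≡.subst (ℕ._≤ _) (length-map decode (roots h))
    (roots≤degree x*y≈0⇒x≈0⊎y≈0 P a≉0
      (AllPairs.map⁺ (AllPairs.map (λ a≢b eq → a≢b (decode-injective eq))
        (Unique.filter⁺ _ (Unique.allFin⁺ q))))
      (All.map⁺ (All.all-filter _ (allFin q))))

  private
    nonsingular? : ∀ (v : Vec (Fin q) n) a → Dec (¬ moore (decode a ⊹ ⟦ v ⟧) ≈ 0#)
    nonsingular? v a = ¬? (moore (decode a ⊹ ⟦ v ⟧) ≈? 0#)

    extensions : Vec (Fin q) n → List (Vec (Fin q) (suc n))
    extensions v = map (_∷ v) (filter (nonsingular? v) (allFin q))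

  -- Only nonsingular vectors are extended: their determinant is the leading coefficient in the new
  -- coordinate, which must be nonzero for the root bound.
  nonsingular : ∀ n → List (Vec (Fin q) n)
  nonsingular zero    = [] ∷ []
  nonsingular (suc n) = concatMap extensions (nonsingular n)

  nonsingular-moore : ∀ n → All (λ v → ¬ moore ⟦ v ⟧ ≈ 0#) (nonsingular n)
  nonsingular-moore zero    = 1≉0 ∷ []
  nonsingular-moore (suc n) = All.concat⁺ (All.map⁺ (All.universal
    (λ v → All.map⁺ (All.all-filter (nonsingular? v) (allFin q))) (nonsingular n)))

  nonsingular-unique : ∀ n → Unique (nonsingular n)
  nonsingular-unique zero    = [] ∷ []
  nonsingular-unique (suc n) = Unique.concat⁺
    (All.map⁺ (All.universal
      (λ v → Unique.map⁺ ∷-injectiveˡ (Unique.filter⁺ (nonsingular? v) (Unique.allFin⁺ q)))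
      (nonsingular n)))
    (AllPairs.map⁺ (AllPairs.map disjoint (nonsingular-unique n)))
    where
    disjoint : ∀ {v w} → ¬ v ≡ w → Disjoint (extensions v) (extensions w)
    disjoint v≢w (u∈v , u∈w) with ∈-map⁻ _ u∈v | ∈-map⁻ _ u∈w
    ... | _ , _ , u≡a∷v | _ , _ , u≡b∷w = v≢w (∷-injectiveʳ (≡.trans (≡.sym u≡a∷v) u≡b∷w))

  -- At most p ^ n ≤ q / 2 values of the new coordinate make the Moore determinant vanish.
  length-extensions : ∀ {n} → n ℕ.< k → ∀ (v : Vec (Fin q) n) → ¬ moore ⟦ v ⟧ ≈ 0# →
                      q ℕ.≤ 2 ℕ.* length (extensions v)
  length-extensions {n} n<k v moore≉0 =
    ≡.subst (λ l → q ℕ.≤ 2 ℕ.* l) (≡.sym (length-map (_∷ v) (filter (nonsingular? v) (allFin q))))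
      (m+n≡o⇒2m≤o⇒o≤2n {m = length (roots (λ a → moore (a ⊹ ⟦ v ⟧)))}
        (≡.trans (length-filter-¬? (λ a → moore (decode a ⊹ ⟦ v ⟧) ≈? 0#) (allFin q)) (length-tabulate id))
        (ℕ.≤-trans (ℕ.*-mono-≤ 1<p (length-roots (moore-Poly ⟦ v ⟧) moore≉0))
          (ℕ.^-monoʳ-≤ p {{ℕ.>-nonZero (ℕ.<⇒≤ 1<p)}} n<k)))

  length-nonsingular : ∀ {n} → n ℕ.≤ k → q ^ℕ n ℕ.≤ 2 ^ℕ n ℕ.* length (nonsingular n)
  length-nonsingular {zero}  _   = ℕ.≤-refl
  length-nonsingular {suc n} n<k = *-chain-≤ q 2 (2 ^ℕ n) (length-nonsingular (ℕ.<⇒≤ n<k))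
    (length-concatMap extensions {d = 2} (All.map (λ {v} → length-extensions n<k v) (nonsingular-moore n)))

  -- The solutions of the degree p equation that `moore-sign` imposes on every value of the
  -- determinant.
  mooreValues : List (Fin q)
  mooreValues = roots (λ y → -1# ^ k-1 * y ^ p + -1# * y)

  length-mooreValues : length mooreValues ℕ.≤ p
  length-mooreValues = length-roots
    -- Since 1 < p, the linear term adds nothing to the coefficient of y ^ p, which stays a sign.
    (Poly-+ (Poly-* (-1# ^ k-1) (Poly-^ p))
      (Poly-cong refl (λ y → *-congˡ (*-identityʳ y)) (Poly-* -1# (Poly-raise (Poly-^ 1) 1<p))))
    λ eq → -1≉0 (x^n≈0⇒x≈0 k-1 (trans (sym leading) eq))
    where
    leading : -1# ^ k-1 * 1# + -1# * 0# ≈ -1# ^ k-1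
    leading = trans (+-cong (*-identityʳ _) (zeroʳ _)) (+-identityʳ _)

    -1≉0 : ¬ -1# ≈ 0#
    -1≉0 -1≈0 = 1≉0 (trans (sym (+-identityʳ 1#)) (trans (+-congˡ (sym -1≈0)) (-‿inverseʳ 1#)))

  moore∈mooreValues : ∀ (x : Vector Carrier k) → code (moore x) ∈ mooreValues
  moore∈mooreValues x = ∈-filter⁺ (λ a → _ ≈? 0#) (∈-allFin _) (begin
    -1# ^ k-1 * decode (code (moore x)) ^ p + -1# * decode (code (moore x))
      ≈⟨ +-cong (*-congˡ (^-congˡ p (decode∘code _))) (*-congˡ (decode∘code _)) ⟩
    -1# ^ k-1 * moore x ^ p + -1# * moore x
      ≈⟨ +-congʳ (moore-sign x) ⟩
    moore x + -1# * moore x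
      ≈⟨ x+-1*x≈0 _ ⟩
    0# ∎)

  private
    popular : ∃ λ y → length (nonsingular k) ℕ.≤
      length mooreValues ℕ.* length (filter (λ v → code (moore ⟦ v ⟧) ≟ y) (nonsingular k))
    -- The default `code 0#` has an empty fibre, all listed vectors being nonsingular.
    popular = pigeonhole-filter _≟_ (λ v → code (moore ⟦ v ⟧)) (code 0#) mooreValues
      (All.universal (λ v → moore∈mooreValues ⟦ v ⟧) (nonsingular k))

    y₀ = proj₁ popular

  levelSet : List (Vec (Fin q) k)
  levelSet = filter (λ v → code (moore ⟦ v ⟧) ≟ y₀) (nonsingular k)

  levelSet-large : q ^ℕ k ℕ.≤ 2 ^ℕ k ℕ.* (p ℕ.* length levelSet)
  levelSet-large = ℕ.≤-trans (length-nonsingular ℕ.≤-refl)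
    (ℕ.*-monoʳ-≤ (2 ^ℕ k) (ℕ.≤-trans (proj₂ popular) (ℕ.*-monoˡ-≤ _ length-mooreValues)))

  -- The induced matching in dimension k + e.

  private
    vertex : Fin (length levelSet) → Vector Carrier k
    vertex a = ⟦ lookup levelSet a ⟧

    vertex-moore≉0 : ∀ a → ¬ moore (vertex a) ≈ 0#
    vertex-moore≉0 a = All.lookup (All.filter⁺ _ (nonsingular-moore k)) (∈-lookup {xs = levelSet} a)

    vertex-moore : ∀ a b → moore (vertex a) ≈ moore (vertex b)
    vertex-moore a b = trans (sym (level a)) (level b)
      where
      level : ∀ a → decode y₀ ≈ moore (vertex a)
      level a = trans (reflexive (≡.cong decode (≡.sym
        (All.lookup (All.all-filter _ (nonsingular k)) (∈-lookup {xs = levelSet} a))))) (decode∘code _)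

    vertex-injective : ∀ {a b} → (∀ i → vertex a i ≈ vertex b i) → a ≡ b
    vertex-injective eq = lookup-injective (Unique.filter⁺ _ (nonsingular-unique k)) _ _
      (⟦⟧-injective _ _ eq)

  module _ (e : ℕ) where
    open Geometry F (k ℕ.+ e)

    private
      height : Fin (q ^ℕ e) → Vector Carrier e
      height b i = decode (finToFun b i)

      point : Fin (length levelSet) × Fin (q ^ℕ e) → Point
      point (a , b) = vertex a Vector.++ height b

      -- The last e coordinates are zero, so each line stays in one slice of constant height.
      direction : Fin (length levelSet) → Point
      direction a = (λ i → vertex a i ^ p) Vector.++ (λ (_ : Fin e) → 0#)

      module _ (a a′ : Fin (length levelSet)) (b b′ : Fin (q ^ℕ e)) (t : Carrier)
               (on : point (a , b) ≋ (λ i → point (a′ , b′) i + t * direction a′ i)) where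
        onˡ : ∀ i → vertex a i ≈ frobeniusLine (vertex a′) t i
        onˡ i = begin
          vertex a i
            ≡⟨ lookup-++ˡ (vertex a) (height b) i ⟨
          point (a , b) (i ↑ˡ e)
            ≈⟨ on (i ↑ˡ e) ⟩
          point (a′ , b′) (i ↑ˡ e) + t * direction a′ (i ↑ˡ e)
            ≡⟨ ≡.cong₂ (λ x y → x + t * y) (lookup-++ˡ (vertex a′) (height b′) i)
                 (lookup-++ˡ (λ i → vertex a′ i ^ p) (λ (_ : Fin e) → 0#) i) ⟩
          frobeniusLine (vertex a′) t i ∎

        onʳ : ∀ i → height b i ≈ height b′ i
        onʳ i = begin
          height b i
            ≡⟨ lookup-++ʳ (vertex a) (height b) i ⟨
          point (a , b) (k ↑ʳ i)
            ≈⟨ on (k ↑ʳ i) ⟩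
          point (a′ , b′) (k ↑ʳ i) + t * direction a′ (k ↑ʳ i)
            ≡⟨ ≡.cong₂ (λ x y → x + t * y) (lookup-++ʳ (vertex a′) (height b′) i)
                 (lookup-++ʳ (λ i → vertex a′ i ^ p) (λ (_ : Fin e) → 0#) i) ⟩
          height b′ i + t * 0#
            ≈⟨ trans (+-congˡ (zeroʳ t)) (+-identityʳ _) ⟩
          height b′ i ∎

        -- Both vertices have the same Moore determinant, and the line through the second meets that
        -- level set at parameter 0 only.
        t≈0 : t ≈ 0#
        t≈0 = frobeniusLine-tangent (vertex-moore≉0 a′)
          (trans (sym (moore-cong onˡ)) (vertex-moore a a′))

        on⇒≡ : (a , b) ≡ (a′ , b′)
        on⇒≡ = ≡.cong₂ _,_
          (vertex-injective λ i → trans (onˡ i)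
            (trans (+-congˡ (trans (*-congʳ t≈0) (zeroˡ _))) (+-identityʳ _)))
          (finToFun-injective {n = e} b b′ (decode-injective ∘ onʳ))

      -- Along a zero direction the parameter 1 would not move the vertex, and tangency would then
      -- give 1 ≈ 0.
      direction≉𝟎 : ∀ a → ¬ direction a ≋ 𝟎
      direction≉𝟎 a direction≋𝟎 = 1≉0 (frobeniusLine-tangent (vertex-moore≉0 a)
        (moore-cong λ i → begin
          vertex a i + 1# * vertex a i ^ p
            ≈⟨ +-congˡ (*-identityˡ _) ⟩
          vertex a i + vertex a i ^ p
            ≡⟨ ≡.cong (vertex a i +_) (lookup-++ˡ (λ i → vertex a i ^ p) (λ (_ : Fin e) → 0#) i) ⟨
          vertex a i + direction a (i ↑ˡ e)
            ≈⟨ trans (+-congˡ (direction≋𝟎 (i ↑ˡ e))) (+-identityʳ _) ⟩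
          vertex a i ∎))

      split : Fin (length levelSet ℕ.* q ^ℕ e) → Fin (length levelSet) × Fin (q ^ℕ e)
      split = remQuot (q ^ℕ e)

      split-injective : ∀ {i j} → split i ≡ split j → i ≡ j
      split-injective {i} {j} eq = ≡.trans (≡.sym (combine-remQuot {length levelSet} (q ^ℕ e) i))
        (≡.trans (≡.cong (λ (a , b) → combine a b) eq) (combine-remQuot {length levelSet} (q ^ℕ e) j))

    tangentMatching : InducedMatching (length levelSet ℕ.* q ^ℕ e)
    tangentMatching = record
      { point    = point ∘ split
      ; line     = λ j → mkLine (point (split j)) (direction (proj₁ (split j))) (direction≉𝟎 _)
      ; incident = λ i j → mk⇔
          (λ (t , on) → split-injective (on⇒≡ _ _ _ _ t on))
          λ { ≡.refl → 0# , λ x → sym (trans (+-congˡ (zeroˡ _)) (+-identityʳ _)) }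
      }

  -- Weakening 2 ^ k to 2 ^ (k + e) makes the constant depend on the dimension alone.
  q^d≤p*2^d*IM : ∀ e → q ^ℕ (k ℕ.+ e) ℕ.≤ p ℕ.* (2 ^ℕ (k ℕ.+ e) ℕ.* IM F (k ℕ.+ e))
  q^d≤p*2^d*IM e = ℕR.begin
    q ^ℕ (k ℕ.+ e)
      ℕR.≡⟨ ℕ.^-distribˡ-+-* q k e ⟩
    q ^ℕ k ℕ.* q ^ℕ e
      ℕR.≤⟨ ℕ.*-monoˡ-≤ (q ^ℕ e) levelSet-large ⟩
    2 ^ℕ k ℕ.* (p ℕ.* length levelSet) ℕ.* q ^ℕ e
      ℕR.≡⟨ ≡.cong (ℕ._* q ^ℕ e) (x∙yz≈y∙xz (2 ^ℕ k) p (length levelSet)) ⟩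
    p ℕ.* (2 ^ℕ k ℕ.* length levelSet) ℕ.* q ^ℕ e
      ℕR.≡⟨ ≡.trans (ℕ.*-assoc p _ _) (≡.cong (p ℕ.*_) (ℕ.*-assoc (2 ^ℕ k) _ _)) ⟩
    p ℕ.* (2 ^ℕ k ℕ.* (length levelSet ℕ.* q ^ℕ e))
      ℕR.≤⟨ ℕ.*-monoʳ-≤ p (ℕ.*-mono-≤ (ℕ.^-monoʳ-≤ 2 (ℕ.m≤m+n k e)) matching≤IM) ⟩
    p ℕ.* (2 ^ℕ (k ℕ.+ e) ℕ.* IM F (k ℕ.+ e)) ℕR.∎
    where
    module ℕR = ℕ.≤-Reasoning
    open CommutativeSemigroupProperties ℕ.*-commutativeSemigroup using (x∙yz≈y∙xz)
    open Geometry F (k ℕ.+ e) using (module IsMaximumMatchingSize)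
    matching≤IM : length levelSet ℕ.* q ^ℕ e ℕ.≤ IM F (k ℕ.+ e)
    matching≤IM = IsMaximumMatchingSize.maximum (proj₂ (maximumMatchingSize F (k ℕ.+ e))) _
      (tangentMatching e)

-- With q = p ^ k the left side is q ^ (d - 1/k), obtained by cancelling one factor p from q ^ d.
p^[d*k∸1]≤2^d*IM : ∀ {c ℓ₁ ℓ₂ d k p} → Prime p → 1 ℕ.≤ k → k ℕ.≤ d →
                   (F : FiniteField c ℓ₁ ℓ₂ (p ^ℕ k)) →
                   p ^ℕ (d ℕ.* k ℕ.∸ 1) ℕ.≤ 2 ^ℕ d ℕ.* IM F d
p^[d*k∸1]≤2^d*IM {d = d} {k = k@(suc k-1)} {p} p-prime _ k≤d F
  with ℕ.m≤n⇒∃[o]m+o≡n k≤d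
-- Now d and k are both successors, so d * k computes to a successor and the truncated subtraction
-- loses nothing.
... | e , ≡.refl = ℕ.*-cancelˡ-≤ p {{ℕ.>-nonZero (ℕ.<⇒≤ (NaturalArithmetic.prime⇒1<p p-prime))}}
  (≡.subst (ℕ._≤ p ℕ.* (2 ^ℕ d ℕ.* IM F d))
    (≡.trans (ℕ.^-*-assoc p k d) (≡.cong (p ^ℕ_) (ℕ.*-comm k d)))
    (MooreMatching.q^d≤p*2^d*IM p-prime k-1 F e))

-- Passage to a rational constant.

open import Data.Integer.Base as ℤ using (+_)
import Data.Integer.Properties as ℤ
open import Data.Nat.Base using (ℕ; _≤_; _∸_; _^_) renaming (_*_ to _*ℕ_)
open import Data.Nat.Primality using (Prime)
open import Data.Product.Base using (∃; _×_)
open import Data.Rational.Base using (ℚ; 0ℚ; toℚᵘ; _/_; _*_) renaming (_≤_ to _≤ℚ_; _<_ to _<ℚ_)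
import Data.Rational.Properties as ℚ
open import Data.Rational.Unnormalised.Base as ℚᵘ using (mkℚᵘ)
import Data.Rational.Unnormalised.Properties as ℚᵘ

-- Unnormalised rationals avoid reduction to lowest terms and leave an inequality of integer cross
-- products.
1/n*a≤b : ∀ n .{{_ : ℕ.NonZero n}} {a b} → a ℕ.≤ n ℕ.* b → + 1 / n * (+ a / 1) ≤ℚ + b / 1
1/n*a≤b n@(suc n-1) {a} {b} a≤nb = ℚ.toℚᵘ-cancel-≤ (begin
  toℚᵘ (+ 1 / n * (+ a / 1))
    ≃⟨ ℚ.toℚᵘ-homo-* (+ 1 / n) (+ a / 1) ⟩
  toℚᵘ (+ 1 / n) ℚᵘ.* toℚᵘ (+ a / 1)
    ≃⟨ ℚᵘ.*-cong (ℚ.toℚᵘ-fromℚᵘ (mkℚᵘ (+ 1) n-1)) (ℚ.toℚᵘ-fromℚᵘ (mkℚᵘ (+ a) 0)) ⟩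
  mkℚᵘ (+ 1) n-1 ℚᵘ.* mkℚᵘ (+ a) 0
    ≤⟨ ℚᵘ.*≤* cross ⟩
  mkℚᵘ (+ b) 0
    ≃⟨ ℚ.toℚᵘ-fromℚᵘ (mkℚᵘ (+ b) 0) ⟨
  toℚᵘ (+ b / 1) ∎)
  where
  open ℚᵘ.≤-Reasoning
  cross : + 1 ℤ.* + a ℤ.* + 1 ℤ.≤ + b ℤ.* + (n ℕ.* 1)
  cross = ≡.subst₂ ℤ._≤_
    (≡.sym (≡.trans (ℤ.*-identityʳ _) (ℤ.*-identityˡ _)))
    (≡.trans (≡.cong +_ (≡.trans (ℕ.*-comm n b) (≡.cong (b ℕ.*_) (≡.sym (ℕ.*-identityʳ n)))))
      (ℤ.pos-* b (n ℕ.* 1)))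
    (ℤ.+≤+ a≤nb)

theorem1p8 : ∀ {c ℓ₁ ℓ₂} (d : ℕ) → 2 ≤ d →
    ∃ λ (c_d : ℚ) → 0ℚ <ℚ c_d ×
    (∀ (k : ℕ) → 2 ≤ k → k ≤ d →
    ∀ (q₀ : ℕ) → Prime q₀ →
    ∀ (F : FiniteField c ℓ₁ ℓ₂ (q₀ ^ k)) →
    c_d * (+ (q₀ ^ (d *ℕ k ∸ 1)) / 1) ≤ℚ + IM F d / 1)
theorem1p8 d _ = + 1 / (2 ^ d) , ℚ.positive⁻¹ _ {{ℚ.normalize-pos 1 (2 ^ d)}} ,
  λ k 2≤k k≤d q₀ q₀-prime F → 1/n*a≤b (2 ^ d) (p^[d*k∸1]≤2^d*IM q₀-prime (ℕ.<⇒≤ 2≤k) k≤d F)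
  where
  instance
    2^d≢0 : ℕ.NonZero (2 ^ d)
    2^d≢0 = ℕ.m^n≢0 2 d
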